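{- Let $q\ge 3$ be an integer. The number $|\mathscr{G}|$ of cyclic subgroups of $(\mathbb{Z}/q\mathbb{Z})^\times$ is given by $$|\mathscr{G}|=\prod_{\substack{p|\varphi(q),\\ p\neq2}}\frac{p-2}{p-1}\ \sum_{\substack{d|\varphi(q),\\ 2|d}}\frac{\rho(q;d)}{\varphi(d)}\prod_{\substack{p|d,\\ p|\varphi(q)/d,\\ p\neq2}}\frac{(p-1)^2}{p(p-2)}\prod_{\substack{p|d,\\ p\nmid\varphi(q)/d,\\ p\neq2}}\frac{p-1}{p-2}\prod_{\substack{2|d,\\ 2|\varphi(q)/d}}\frac12,$$ where $p$ denotes primes and the last product equals $\frac12$ if $2|d$ and $2|\varphi(q)/d$, and $1$ otherwise.
   Context: $\varphi$ is Euler's totient function. $\rho(q;d)$ is the number of solutions $x\in\mathbb{Z}/q\mathbb{Z}$ of $x^d\equiv 1 \bmod q$. It is multiplicative in $q$, and for a prime $p$ and $\alpha\ge1$: $\rho(p^\alpha;d)=\gcd(d,p^{\alpha-1}(p-1))$ if $p\ne2$; $\rho(2;d)=1$; for $\alpha\ge2$, $\rho(2^\alpha;d)=1$ if $d$ is odd and $\rho(2^\alpha;d)=2\gcd(d,2^{\alpha-2})$ if $d$ is even. -}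

module Defs where

open import Algebra.Bundles using (Monoid; Group; CommutativeRing)
import Algebra.Definitions.RawMonoid as RawMonoidDefs
open import Data.Fin.Base using (Fin)
open import Data.Integer.Base as ℤ using (ℤ; +_; -[1+_])
import Data.Integer.Properties as ℤ
open import Data.Integer.Divisibility.Signed as ℤ using (divides)
open import Data.Integer.Tactic.RingSolver using (solve-∀)
open import Data.List.Base using (List; filter; foldr; length; map; upTo)
open import Data.Nat.Base as ℕ using (ℕ; zero; suc)
open import Data.Nat.Coprimality using (coprime?)
open import Data.Nat.Divisibility using (_∣?_)
import Data.Nat.DivMod as ℕ
open import Data.Nat.Primality using (prime?)
import Data.Nat.Properties as ℕ
open import Data.Product.Base using (∃-syntax; _×_; _,_)
open import Data.Rational.Base as ℚ using (ℚ; 0ℚ; 1ℚ)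
open import Function.Bundles using (Bijection)
open import Level using (Level; _⊔_; 0ℓ) renaming (suc to lsuc)
open import Relation.Binary.Bundles using (Setoid)
open import Relation.Binary.Definitions using (_Respects_)
open import Relation.Binary.PropositionalEquality.Core using (_≡_; refl; subst)
open import Relation.Binary.PropositionalEquality.Properties using (setoid)
open import Relation.Nullary.Decidable using (Dec; _×-dec_; ¬?)
open import Relation.Unary using (Pred; _∈_; _≐_)
open import Relation.Unary.Properties using (≐-refl; ≐-sym; ≐-trans)

private
  variable
    c ℓ : Level

-- S has exactly n elements, counted up to the equality of S.
HasCardinality : Setoid c ℓ → ℕ → Set (c ⊔ ℓ)
HasCardinality S n = Bijection (setoid (Fin n)) S

module _ (G : Group c ℓ) where
  open Group G
  open RawMonoidDefs rawMonoid using () renaming (_×_ to _·_)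

  _^ᶻ_ : Carrier → ℤ → Carrier
  g ^ᶻ (+ n)    = n · g
  g ^ᶻ -[1+ n ] = (suc n · g) ⁻¹

  record IsSubgroup {p} (H : Pred Carrier p) : Set (c ⊔ ℓ ⊔ p) where
    field
      respects  : H Respects _≈_
      ε-closed  : ε ∈ H
      ∙-closed  : ∀ {x y} → x ∈ H → y ∈ H → (x ∙ y) ∈ H
      ⁻¹-closed : ∀ {x} → x ∈ H → (x ⁻¹) ∈ H

  IsCyclic : ∀ {p} → Pred Carrier p → Set (c ⊔ ℓ ⊔ p)
  IsCyclic H = ∃[ g ] (g ∈ H × (∀ {x} → x ∈ H → ∃[ k ] (x ≈ (g ^ᶻ k))))

  record CyclicSubgroup p : Set (c ⊔ ℓ ⊔ lsuc p) where
    field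
      members    : Pred Carrier p
      isSubgroup : IsSubgroup members
      isCyclic   : IsCyclic members

  open CyclicSubgroup

  -- Two cyclic subgroups are identified when they have the same members; the
  -- generator recorded in isCyclic is ignored.
  cyclicSubgroups : ∀ p → Setoid (c ⊔ ℓ ⊔ lsuc p) (c ⊔ p)
  cyclicSubgroups p = record
    { Carrier       = CyclicSubgroup p
    ; _≈_           = λ H K → members H ≐ members K
    ; isEquivalence = record { refl = ≐-refl ; sym = ≐-sym ; trans = ≐-trans }
    }

module _ (M : Monoid c ℓ) where
  open Monoid M hiding (refl)
  open import Relation.Binary.Reasoning.Setoid (Monoid.setoid M)

  record Unit : Set (c ⊔ ℓ) where
    field
      value    : Carrier
      inverse  : Carrier
      inverseˡ : inverse ∙ value ≈ ε
      inverseʳ : value ∙ inverse ≈ ε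

  open Unit

  private
    cancel : ∀ {a b a′ b′} → a′ ∙ a ≈ ε → b′ ∙ b ≈ ε → (b′ ∙ a′) ∙ (a ∙ b) ≈ ε
    cancel {a} {b} {a′} {b′} p r = begin
      (b′ ∙ a′) ∙ (a ∙ b) ≈⟨ assoc b′ a′ (a ∙ b) ⟩
      b′ ∙ (a′ ∙ (a ∙ b)) ≈⟨ ∙-congˡ (assoc a′ a b) ⟨
      b′ ∙ ((a′ ∙ a) ∙ b) ≈⟨ ∙-congˡ (∙-congʳ p) ⟩
      b′ ∙ (ε ∙ b)        ≈⟨ ∙-congˡ (identityˡ b) ⟩
      b′ ∙ b              ≈⟨ r ⟩
      ε                   ∎

    inverse-cong : ∀ (u v : Unit) → value u ≈ value v → inverse u ≈ inverse v
    inverse-cong u v p = begin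
      inverse u                         ≈⟨ identityʳ _ ⟨
      inverse u ∙ ε                     ≈⟨ ∙-congˡ (inverseʳ v) ⟨
      inverse u ∙ (value v ∙ inverse v) ≈⟨ ∙-congˡ (∙-congʳ p) ⟨
      inverse u ∙ (value u ∙ inverse v) ≈⟨ assoc _ _ _ ⟨
      (inverse u ∙ value u) ∙ inverse v ≈⟨ ∙-congʳ (inverseˡ u) ⟩
      ε ∙ inverse v                     ≈⟨ identityˡ _ ⟩
      inverse v                         ∎

  units : Group (c ⊔ ℓ) ℓ
  units = record
    { Carrier = Unit
    ; _≈_     = λ u v → value u ≈ value v
    ; _∙_     = λ u v → record
        { value    = value u ∙ value v
        ; inverse  = inverse v ∙ inverse u
        ; inverseˡ = cancel (inverseˡ u) (inverseˡ v)
        ; inverseʳ = cancel (inverseʳ v) (inverseʳ u)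
        }
    ; ε       = record
        { value = ε ; inverse = ε
        ; inverseˡ = identityˡ ε ; inverseʳ = identityˡ ε }
    ; _⁻¹     = λ u → record
        { value = inverse u ; inverse = value u
        ; inverseˡ = inverseʳ u ; inverseʳ = inverseˡ u }
    ; isGroup = record
        { isMonoid = record
          { isSemigroup = record
            { isMagma = record
              { isEquivalence = record
                { refl = Monoid.refl M ; sym = sym ; trans = trans }
              ; ∙-cong = ∙-cong
              }
            ; assoc = λ u v w → assoc (value u) (value v) (value w)
            }
          ; identity = (λ u → identityˡ (value u)) , (λ u → identityʳ (value u))
          }
        ; inverse = inverseˡ , inverseʳ
        ; ⁻¹-cong = λ {u} {v} → inverse-cong u v
        }
    }

infix 4 _≡_[mod_] _≡?_[mod_]

_≡_[mod_] : ℤ → ℤ → ℕ → Set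
x ≡ y [mod q ] = (+ q) ℤ.∣ (x ℤ.- y)

_≡?_[mod_] : ∀ x y q → Dec (x ≡ y [mod q ])
x ≡? y [mod q ] = (+ q) ℤ.∣? (x ℤ.- y)

module _ (q : ℕ) where
  private
    infix 4 _≈_
    _≈_ : ℤ → ℤ → Set
    x ≈ y = x ≡ y [mod q ]

    ≈-reflexive : ∀ {x y} → x ≡ y → x ≈ y
    ≈-reflexive {x} refl = divides ℤ.0ℤ (ℤ.+-inverseʳ x)

    ≈-sym : ∀ {x y} → x ≈ y → y ≈ x
    ≈-sym {x} {y} p = subst ((+ q) ℤ.∣_) (eq x y) (ℤ.∣m⇒∣-m p)
      where
      eq : ∀ x y → ℤ.- (x ℤ.- y) ≡ y ℤ.- x
      eq = solve-∀

    ≈-trans : ∀ {x y z} → x ≈ y → y ≈ z → x ≈ z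
    ≈-trans {x} {y} {z} p r = subst ((+ q) ℤ.∣_) (eq x y z) (ℤ.∣m∣n⇒∣m+n p r)
      where
      eq : ∀ x y z → (x ℤ.- y) ℤ.+ (y ℤ.- z) ≡ x ℤ.- z
      eq = solve-∀

    +-cong : ∀ {x y u v} → x ≈ y → u ≈ v → x ℤ.+ u ≈ y ℤ.+ v
    +-cong {x} {y} {u} {v} p r =
      subst ((+ q) ℤ.∣_) (eq x y u v) (ℤ.∣m∣n⇒∣m+n p r)
      where
      eq : ∀ x y u v → (x ℤ.- y) ℤ.+ (u ℤ.- v) ≡ (x ℤ.+ u) ℤ.- (y ℤ.+ v)
      eq = solve-∀

    *-cong : ∀ {x y u v} → x ≈ y → u ≈ v → x ℤ.* u ≈ y ℤ.* v
    *-cong {x} {y} {u} {v} p r =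
      subst ((+ q) ℤ.∣_) (eq x y u v)
        (ℤ.∣m∣n⇒∣m+n (ℤ.∣m⇒∣m*n u p) (ℤ.∣n⇒∣m*n y r))
      where
      eq : ∀ x y u v →
           (x ℤ.- y) ℤ.* u ℤ.+ y ℤ.* (u ℤ.- v) ≡ x ℤ.* u ℤ.- y ℤ.* v
      eq = solve-∀

    neg-cong : ∀ {x y} → x ≈ y → ℤ.- x ≈ ℤ.- y
    neg-cong {x} {y} p = subst ((+ q) ℤ.∣_) (eq x y) (ℤ.∣m⇒∣-m p)
      where
      eq : ∀ x y → ℤ.- (x ℤ.- y) ≡ ℤ.- x ℤ.- (ℤ.- y)
      eq = solve-∀

  ℤ/_ : CommutativeRing 0ℓ 0ℓ
  ℤ/_ = record
    { Carrier = ℤ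
    ; _≈_     = _≈_
    ; _+_     = ℤ._+_
    ; _*_     = ℤ._*_
    ; -_      = ℤ.-_
    ; 0#      = ℤ.0ℤ
    ; 1#      = ℤ.1ℤ
    ; isCommutativeRing = record
      { isRing = record
        { +-isAbelianGroup = record
          { isGroup = record
            { isMonoid = record
              { isSemigroup = record
                { isMagma = record
                  { isEquivalence = record
                    { refl  = λ {x} → ≈-reflexive {x} refl
                    ; sym   = λ {x} {y} → ≈-sym {x} {y}
                    ; trans = λ {x} {y} {z} → ≈-trans {x} {y} {z}
                    }
                  ; ∙-cong = λ {x} {y} {u} {v} → +-cong {x} {y} {u} {v}
                  }
                ; assoc = λ x y z → ≈-reflexive (ℤ.+-assoc x y z)
                }
              ; identity = (λ x → ≈-reflexive (ℤ.+-identityˡ x))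
                         , (λ x → ≈-reflexive (ℤ.+-identityʳ x))
              }
            ; inverse = (λ x → ≈-reflexive (ℤ.+-inverseˡ x))
                      , (λ x → ≈-reflexive (ℤ.+-inverseʳ x))
            ; ⁻¹-cong = λ {x} {y} → neg-cong {x} {y}
            }
          ; comm = λ x y → ≈-reflexive (ℤ.+-comm x y)
          }
        ; *-cong = λ {x} {y} {u} {v} → *-cong {x} {y} {u} {v}
        ; *-assoc = λ x y z → ≈-reflexive (ℤ.*-assoc x y z)
        ; *-identity = (λ x → ≈-reflexive (ℤ.*-identityˡ x))
                     , (λ x → ≈-reflexive (ℤ.*-identityʳ x))
        ; distrib = (λ x y z → ≈-reflexive (ℤ.*-distribˡ-+ x y z))
                  , (λ x y z → ≈-reflexive (ℤ.*-distribʳ-+ x y z))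
        }
      ; *-comm = λ x y → ≈-reflexive (ℤ.*-comm x y)
      }
    }

  [ℤ/_]ˣ : Group 0ℓ 0ℓ
  [ℤ/_]ˣ = units (CommutativeRing.*-monoid ℤ/_)

φ : ℕ → ℕ
φ n = length (filter (λ k → coprime? k n) (map suc (upTo n)))

-- 0, …, q - 1 represent each class of ℤ/qℤ once.
ρ : ℕ → ℕ → ℕ
ρ q d = length (filter (λ x → ((+ x) ℤ.^ d) ≡? ℤ.1ℤ [mod q ]) (upTo q))

-- The positive divisors of n, for n > 0.
divisors : ℕ → List ℕ
divisors n = filter (_∣? n) (map suc (upTo n))

evenDivisors : ℕ → List ℕ
evenDivisors n = filter (2 ∣?_) (divisors n)

oddPrimeDivisors : ℕ → List ℕ
oddPrimeDivisors n = filter (λ p → prime? p ×-dec ¬? (p ℕ.≟ 2)) (divisors n)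

∑ ∏ : List ℕ → (ℕ → ℚ) → ℚ
∑ xs f = foldr ℚ._+_ 0ℚ (map f xs)
∏ xs f = foldr ℚ._*_ 1ℚ (map f xs)

syntax ∑ xs (λ x → e) = ∑[ x ∈ xs ] e
syntax ∏ xs (λ x → e) = ∏[ x ∈ xs ] e

infixl 8 _//_ _quo_

-- Both quotients are totalised by the value 0 at denominator 0. They are
-- applied to denominators such as p ∸ 2 (p an odd prime), d and φ d (d ≥ 1),
-- which are positive.
_//_ : ℕ → ℕ → ℚ
m // zero    = 0ℚ
m // (suc n) = (+ m) ℚ./ suc n

_quo_ : ℕ → ℕ → ℕ
m quo zero    = 0
m quo (suc n) = m ℕ./ suc n

{-# OPTIONS --safe #-}

-- Grouping the elements of a finite abelian group by the cyclic subgroup they generate, the number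
-- of cyclic subgroups is Σ_g 1/φ(ord g). Let f(p, d) = (p − 1)/p if p ∣ d and (p − 2)/(p − 1)
-- otherwise, so that 1/φ(m) = 1/φ(p m) + f(p, m)/φ(m), and let c(d, r) = 1/φ(d) ∏_{p ∣ r} f(p, d).
-- Telescoping one prime at a time, the sum of c(d, n/d) over m ∣ d ∣ n is 1/φ(m). Take n = φ(q) and
-- sum over the orders m = ord g: since ord g ∣ d means g^d = 1, exchanging the sums gives
-- Σ_{d ∣ n} c(d, n/d) ρ(q; d). The residue −1 has order 2, so n is even, and the terms with d odd
-- vanish because f(2, d) = 0.
module Submission where

open import Defs
open import Algebra.Bundles using (CommutativeMonoid; CommutativeRing; CommutativeSemigroup; Group)
import Algebra.Properties.CommutativeMonoid.Sum
import Algebra.Properties.CommutativeSemigroup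
import Algebra.Properties.Group
import Algebra.Properties.Monoid.Mult
open import Algebra.Structures using (IsCommutativeMonoid)
open import Data.Bool.Base using (Bool; true; false; if_then_else_; not; _∧_)
open import Data.Fin.Base as Fin using (Fin; toℕ; fromℕ<)
import Data.Fin.Permutation as Perm
import Data.Fin.Properties as Fin
open import Data.Integer.Base as ℤ using (ℤ)
import Data.Integer.DivMod as ℤ
import Data.Integer.Divisibility.Signed as ℤ
import Data.Integer.Properties as ℤ
import Data.Integer.Tactic.RingSolver as ℤ
open import Data.List.Base
  using (List; []; _∷_; _++_; allFin; deduplicate; filter; foldr; length; lookup; map; upTo)
open import Data.List.Membership.Propositional using (_∈_)
open import Data.List.Membership.Propositional.Properties
  using (∈-++⁺ˡ; ∈-++⁺ʳ; ∈-++⁻; ∈-allFin; ∈-filter⁺; ∈-filter⁻; ∈-length; ∈-lookup; ∈-map⁺; ∈-map⁻;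
         ∈-upTo⁺; ∈-upTo⁻)
open import Data.List.Membership.Propositional.Properties.WithK using (unique∧set⇒bag)
import Data.List.Membership.Setoid.Properties as Membershipₛ
open import Data.List.Properties using (filter-≐; length-++; length-map; map-∘)
open import Data.List.Relation.Binary.BagAndSetEquality using (∼bag⇒↭)
open import Data.List.Relation.Binary.Permutation.Propositional using (_↭_; ↭⇒↭ₛ)
import Data.List.Relation.Binary.Permutation.Propositional.Properties as ↭
import Data.List.Relation.Binary.Permutation.Setoid.Properties as ↭ₛ
open import Data.List.Relation.Unary.All as All using ([]; _∷_)
import Data.List.Relation.Unary.All.Properties as All
open import Data.List.Relation.Unary.AllPairs using (AllPairs; []; _∷_)
open import Data.List.Relation.Unary.Any as Any using (Any; here; there)
import Data.List.Relation.Unary.Any.Properties as Any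
import Data.List.Relation.Unary.Unique.DecSetoid.Properties as Uniqueₛ
open import Data.List.Relation.Unary.Unique.Propositional using (Unique)
import Data.List.Relation.Unary.Unique.Propositional.Properties as Unique
open import Data.Nat.Base as ℕ
  using (ℕ; zero; suc; NonZero; _≤_; _<_; z≤n; s≤s; _∸_; _^_; pred) renaming (_*_ to _*ℕ_)
open import Data.Nat.Coprimality as Coprime
  using (Coprime; coprime?; coprime-Bézout; coprime-divisor; 1-coprimeTo)
open import Data.Nat.Divisibility
open import Data.Nat.DivMod using (_%_; _/_; m≡m%n+[m/n]*n; m%n<n; m*n/n≡m)
open import Data.Nat.GCD using (module Bézout)
open import Data.Nat.Induction using (<-rec)
open import Data.Nat.ListAction using (product)
open import Data.Nat.Primality
open import Data.Nat.Primality.Factorisation using (factorise)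
import Data.Nat.Properties as ℕ
open import Data.Nat.Tactic.RingSolver using (solve-∀)
open import Data.Product.Base using (∃-syntax; Σ-syntax; _×_; _,_; proj₁; proj₂)
open import Data.Rational.Base as ℚ using (ℚ; 0ℚ; 1ℚ; ½; _+_; _*_; fromℚᵘ)
import Data.Rational.Properties as ℚ
import Data.Rational.Unnormalised.Base as ℚᵘ
import Data.Rational.Unnormalised.Properties as ℚᵘ
open import Data.Sum.Base as Sum using (_⊎_; inj₁; inj₂; [_,_]′)
open import Function.Base using (_∘_)
open import Function.Bundles using (Bijection; mk⇔)
open import Level using (Level; 0ℓ)
open import Relation.Binary.Bundles using (DecSetoid; Setoid)
open import Relation.Binary.PropositionalEquality as ≡
  using (_≡_; _≢_; refl; sym; trans; cong; cong₂; subst; module ≡-Reasoning)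
import Relation.Binary.Reasoning.Setoid
open import Relation.Nullary.Decidable
  using (Dec; yes; no; does; dec-true; dec-false; isYes≗does; map′; ¬?; _×-dec_; ⌊_⌋)
open import Relation.Nullary.Negation using (¬_; contradiction)
open import Relation.Unary using (Decidable; Pred)

-- The coefficient c(d, n/d) is not yet the summand of the theorem, which pulls ∏ (p - 2)/(p - 1)
-- over all odd p ∣ n out of the sum. Inside the sum every odd prime therefore has to be corrected.
-- Write n = r d. If p divides both d and r, the factor in c(d, r) is (p - 1)/p, and its quotient by
-- (p - 2)/(p - 1) is (p - 1)²/(p (p - 2)). If p divides d only, c(d, r) has no factor for p, so the
-- correction is (p - 1)/(p - 2). If p divides r only, the factor is (p - 2)/(p - 1) itself and no
-- correction occurs. At p = 2 the factor pulled out would be 0 and could not be divided out again.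
-- Hence 2 is kept apart: an even d retains the factor f(2, d) = 1/2 exactly when r is even, and the
-- terms with odd d are discarded before the products are compared.

private
  variable
    a b p : Level
    S T : Set a

-- Big operators over lists

-- All reindexings of sums, products and counts go through this lemma: duplicate-free lists are
-- compared by membership, whatever their order.
unique-↭ : {xs ys : List S} → Unique xs → Unique ys →
           (∀ {x} → x ∈ xs → x ∈ ys) → (∀ {x} → x ∈ ys → x ∈ xs) → xs ↭ ys
unique-↭ u v f g = ∼bag⇒↭ (unique∧set⇒bag u v (mk⇔ f g))

-- Injectivity is asked on the members of `xs` only, because k ↦ k · x is injective merely on the
-- exponents up to the order of x.
unique-map : {f : S → T} {xs : List S} → (∀ {x y} → x ∈ xs → y ∈ xs → f x ≡ f y → x ≡ y) →
             Unique xs → Unique (map f xs)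
unique-map inj []       = []
unique-map inj (x∉ ∷ u) =
  All.map⁺ (All.tabulate λ y∈ fx≡fy → All.lookup x∉ y∈ (inj (here refl) (there y∈) fx≡fy))
  ∷ unique-map (λ x∈ y∈ → inj (there x∈) (there y∈)) u

if-yes : ∀ {P : Set p} (P? : Dec P) {x y : S} → P → (if does P? then x else y) ≡ x
if-yes P? h rewrite dec-true P? h = refl

if-no : ∀ {P : Set p} (P? : Dec P) {x y : S} → ¬ P → (if does P? then x else y) ≡ y
if-no P? h rewrite dec-false P? h = refl

if-⇔ : ∀ {q} {P : Set p} {Q : Set q} (P? : Dec P) (Q? : Dec Q) {x y : S} → (P → Q) → (Q → P) →
       (if does P? then x else y) ≡ (if does Q? then x else y)
if-⇔ (yes h) Q? f g = sym (if-yes Q? (f h))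
if-⇔ (no h)  Q? f g = sym (if-no Q? (h ∘ g))

-- `⨀` unfolds to the same fold as `∑` and `∏`, so its lemmas apply to the sums and products of the
-- theorem as they stand, and also to sums over other index types such as `Fin n`.
module BigOperator {a} {M : Set a} {_∙_ : M → M → M} {ε : M}
                   (isCM : IsCommutativeMonoid _≡_ _∙_ ε) where
  open IsCommutativeMonoid isCM using (assoc; comm; identityˡ; isCommutativeSemigroup)
  private
    commutativeSemigroup : CommutativeSemigroup a a
    commutativeSemigroup = record { isCommutativeSemigroup = isCommutativeSemigroup }
  open Algebra.Properties.CommutativeSemigroup commutativeSemigroup using (interchange)
  open ≡-Reasoning

  ⨀ : ∀ {b} {B : Set b} → List B → (B → M) → M
  ⨀ xs f = foldr _∙_ ε (map f xs)

  module _ {b} {B : Set b} where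

    ⨀-cong : ∀ (xs : List B) {f g : B → M} → (∀ {x} → x ∈ xs → f x ≡ g x) → ⨀ xs f ≡ ⨀ xs g
    ⨀-cong []       eq = refl
    ⨀-cong (x ∷ xs) eq = cong₂ _∙_ (eq (here refl)) (⨀-cong xs (eq ∘ there))

    ⨀-ε : ∀ (xs : List B) {f : B → M} → (∀ {x} → x ∈ xs → f x ≡ ε) → ⨀ xs f ≡ ε
    ⨀-ε []       eq = refl
    ⨀-ε (x ∷ xs) eq = trans (cong₂ _∙_ (eq (here refl)) (⨀-ε xs (eq ∘ there))) (identityˡ ε)

    ⨀-∙ : ∀ (xs : List B) (f g : B → M) → ⨀ xs (λ x → f x ∙ g x) ≡ ⨀ xs f ∙ ⨀ xs g
    ⨀-∙ []       f g = sym (identityˡ ε)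
    ⨀-∙ (x ∷ xs) f g = trans (cong ((f x ∙ g x) ∙_) (⨀-∙ xs f g)) (interchange _ _ _ _)

    ⨀-filter : ∀ {P : Pred B p} (P? : Decidable P) xs (f : B → M) →
               ⨀ (filter P? xs) f ≡ ⨀ xs (λ x → if does (P? x) then f x else ε)
    ⨀-filter P? []       f = refl
    ⨀-filter P? (x ∷ xs) f with does (P? x)
    ... | true  = cong (f x ∙_) (⨀-filter P? xs f)
    ... | false = trans (⨀-filter P? xs f) (sym (identityˡ _))

    ⨀-split : ∀ {P : Pred B p} (P? : Decidable P) xs (f : B → M) →
              ⨀ xs f ≡ ⨀ (filter P? xs) f ∙ ⨀ (filter (¬? ∘ P?) xs) f
    ⨀-split P? []       f = sym (identityˡ ε)
    ⨀-split P? (x ∷ xs) f with does (P? x)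
    ... | true  = trans (cong (f x ∙_) (⨀-split P? xs f)) (sym (assoc _ _ _))
    ... | false = begin
      f x ∙ ⨀ xs f       ≡⟨ cong (f x ∙_) (⨀-split P? xs f) ⟩
      f x ∙ (s ∙ t)      ≡⟨ assoc (f x) s t ⟨
      (f x ∙ s) ∙ t      ≡⟨ cong (_∙ t) (comm (f x) s) ⟩
      (s ∙ f x) ∙ t      ≡⟨ assoc s (f x) t ⟩
      s ∙ (f x ∙ t)      ∎
      where s = ⨀ (filter P? xs) f ; t = ⨀ (filter (¬? ∘ P?) xs) f

    ⨀-↭ : ∀ {xs ys : List B} (f : B → M) → xs ↭ ys → ⨀ xs f ≡ ⨀ ys f
    ⨀-↭ f xs↭ys = ↭ₛ.foldr-commMonoid (≡.setoid M) isCM (↭⇒↭ₛ (↭.map⁺ f xs↭ys))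

    ⨀-map : ∀ {c} {C : Set c} (g : C → B) xs (f : B → M) → ⨀ (map g xs) f ≡ ⨀ xs (f ∘ g)
    ⨀-map g xs f = cong (foldr _∙_ ε) (sym (map-∘ xs))

  ⨀-swap : ∀ {b c} {B : Set b} {C : Set c} (xs : List B) (ys : List C) (f : B → C → M) →
           ⨀ xs (λ x → ⨀ ys (f x)) ≡ ⨀ ys (λ y → ⨀ xs (λ x → f x y))
  ⨀-swap []       ys f = sym (⨀-ε ys λ _ → refl)
  ⨀-swap (x ∷ xs) ys f = trans (cong (⨀ ys (f x) ∙_) (⨀-swap xs ys f)) (sym (⨀-∙ ys _ _))

open BigOperator ℚ.+-0-isCommutativeMonoid using () renaming
  (⨀-cong to ∑-cong; ⨀-ε to ∑-0; ⨀-filter to ∑-filter;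
   ⨀-split to ∑-split; ⨀-↭ to ∑-↭; ⨀-map to ∑-map; ⨀-swap to ∑-swap; ⨀ to ∑′)
open BigOperator ℚ.*-1-isCommutativeMonoid using () renaming
  (⨀-cong to ∏-cong; ⨀-∙ to ∏-*; ⨀-filter to ∏-filter;
   ⨀-↭ to ∏-↭)

-- Quotients of natural numbers as rationals

-- `m // suc n` is by definition `fromℚᵘ` of an unreduced fraction, so computing before `fromℚᵘ`
-- avoids reduction to lowest terms.
fromℚᵘ-homo-* : ∀ p q → fromℚᵘ p * fromℚᵘ q ≡ fromℚᵘ (p ℚᵘ.* q)
fromℚᵘ-homo-* p q = ℚ.toℚᵘ-injective (ℚᵘ.≃-trans (ℚ.toℚᵘ-homo-* (fromℚᵘ p) (fromℚᵘ q))
  (ℚᵘ.≃-trans (ℚᵘ.*-cong (ℚ.toℚᵘ-fromℚᵘ p) (ℚ.toℚᵘ-fromℚᵘ q)) (ℚᵘ.≃-sym (ℚ.toℚᵘ-fromℚᵘ _))))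

fromℚᵘ-homo-+ : ∀ p q → fromℚᵘ p + fromℚᵘ q ≡ fromℚᵘ (p ℚᵘ.+ q)
fromℚᵘ-homo-+ p q = ℚ.toℚᵘ-injective (ℚᵘ.≃-trans (ℚ.toℚᵘ-homo-+ (fromℚᵘ p) (fromℚᵘ q))
  (ℚᵘ.≃-trans (ℚᵘ.+-cong (ℚ.toℚᵘ-fromℚᵘ p) (ℚ.toℚᵘ-fromℚᵘ q)) (ℚᵘ.≃-sym (ℚ.toℚᵘ-fromℚᵘ _))))

//-cross : ∀ a b c d .{{_ : NonZero b}} .{{_ : NonZero d}} → a ℕ.* d ≡ c ℕ.* b → a // b ≡ c // d
//-cross a (suc b) c (suc d) eq = ℚ.fromℚᵘ-cong {ℚᵘ.mkℚᵘ (ℤ.+ a) b} {ℚᵘ.mkℚᵘ (ℤ.+ c) d} (ℚᵘ.*≡* (begin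
  ℤ.+ a ℤ.* ℤ.+ suc d ≡⟨ ℤ.pos-* a (suc d) ⟨
  ℤ.+ (a ℕ.* suc d)   ≡⟨ cong ℤ.+_ eq ⟩
  ℤ.+ (c ℕ.* suc b)   ≡⟨ ℤ.pos-* c (suc b) ⟩
  ℤ.+ c ℤ.* ℤ.+ suc b ∎))
  where open ≡-Reasoning

//-* : ∀ a b c d .{{_ : NonZero b}} .{{_ : NonZero d}} → (a // b) * (c // d) ≡ (a ℕ.* c) // (b ℕ.* d)
//-* a (suc b) c (suc d) = trans (fromℚᵘ-homo-* (ℚᵘ.mkℚᵘ (ℤ.+ a) b) (ℚᵘ.mkℚᵘ (ℤ.+ c) d))
  (cong (λ z → z ℚ./ (suc b ℕ.* suc d)) (sym (ℤ.pos-* a c)))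

//-+ : ∀ a b c .{{_ : NonZero c}} → (a // c) + (b // c) ≡ (a ℕ.+ b) // c
//-+ a b (suc c) = trans (fromℚᵘ-homo-+ (ℚᵘ.mkℚᵘ (ℤ.+ a) c) (ℚᵘ.mkℚᵘ (ℤ.+ b) c))
  (ℚ.fromℚᵘ-cong {ℚᵘ.mkℚᵘ (ℤ.+ a) c ℚᵘ.+ ℚᵘ.mkℚᵘ (ℤ.+ b) c} {ℚᵘ.mkℚᵘ (ℤ.+ (a ℕ.+ b)) c} (ℚᵘ.*≡* (begin
    (ℤ.+ a ℤ.* ℤ.+ suc c ℤ.+ ℤ.+ b ℤ.* ℤ.+ suc c) ℤ.* ℤ.+ suc c
      ≡⟨ cong (ℤ._* ℤ.+ suc c) (ℤ.*-distribʳ-+ (ℤ.+ suc c) (ℤ.+ a) (ℤ.+ b)) ⟨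
    ℤ.+ (a ℕ.+ b) ℤ.* ℤ.+ suc c ℤ.* ℤ.+ suc c
      ≡⟨ ℤ.*-assoc (ℤ.+ (a ℕ.+ b)) (ℤ.+ suc c) (ℤ.+ suc c) ⟩
    ℤ.+ (a ℕ.+ b) ℤ.* (ℤ.+ suc c ℤ.* ℤ.+ suc c)
      ≡⟨ cong (ℤ.+ (a ℕ.+ b) ℤ.*_) (ℤ.pos-* (suc c) (suc c)) ⟨
    ℤ.+ (a ℕ.+ b) ℤ.* ℤ.+ (suc c ℕ.* suc c) ∎)))
  where open ≡-Reasoning

n//n≡1 : ∀ n .{{_ : NonZero n}} → n // n ≡ 1ℚ
n//n≡1 n = //-cross n n 1 1 (ℕ.*-comm n 1)

m//n*n//m≡1 : ∀ m n .{{_ : NonZero m}} .{{_ : NonZero n}} → (m // n) * (n // m) ≡ 1ℚ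
m//n*n//m≡1 m n = trans (//-* m n n m)
  (trans (cong ((m ℕ.* n) //_) (ℕ.*-comm n m)) (n//n≡1 (m ℕ.* n) {{ℕ.m*n≢0 m n}}))

*-distribˡ-∑ : ∀ {b} {B : Set b} c (xs : List B) (f : B → ℚ) → c * ∑′ xs f ≡ ∑′ xs (λ x → c * f x)
*-distribˡ-∑ c []       f = ℚ.*-zeroʳ c
*-distribˡ-∑ c (x ∷ xs) f = trans (ℚ.*-distribˡ-+ c (f x) _) (cong (c * f x +_) (*-distribˡ-∑ c xs f))

∑-1 : ∀ {b} {B : Set b} (xs : List B) → ∑′ xs (λ _ → 1ℚ) ≡ length xs // 1
∑-1 []       = refl
∑-1 (x ∷ xs) = trans (cong (1ℚ +_) (∑-1 xs)) (//-+ 1 (length xs) 1)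

∑-const : ∀ {b} {B : Set b} c (xs : List B) → ∑′ xs (λ _ → c) ≡ (length xs // 1) * c
∑-const c xs = begin
  ∑′ xs (λ _ → c)        ≡⟨ ∑-cong xs (λ _ → sym (ℚ.*-identityʳ c)) ⟩
  ∑′ xs (λ _ → c * 1ℚ)   ≡⟨ *-distribˡ-∑ c xs (λ _ → 1ℚ) ⟨
  c * ∑′ xs (λ _ → 1ℚ)   ≡⟨ cong (c *_) (∑-1 xs) ⟩
  c * (length xs // 1)   ≡⟨ ℚ.*-comm c _ ⟩
  (length xs // 1) * c   ∎
  where open ≡-Reasoning

-- Divisors and Euler's totient

range : ℕ → List ℕ
range n = map suc (upTo n)

∈-range⁺ : ∀ {x n} → 1 ≤ x → x ≤ n → x ∈ range n
∈-range⁺ {suc x} _ x<n = ∈-map⁺ suc (∈-upTo⁺ x<n)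

∈-range⁻ : ∀ {x n} → x ∈ range n → 1 ≤ x × x ≤ n
∈-range⁻ x∈ with y , y∈ , refl ← ∈-map⁻ suc x∈ = s≤s z≤n , ∈-upTo⁻ y∈

unique-range : ∀ n → Unique (range n)
unique-range n = Unique.map⁺ ℕ.suc-injective (Unique.upTo⁺ n)

∣⇒≥1 : ∀ {d n} .{{_ : NonZero n}} → d ∣ n → 1 ≤ d
∣⇒≥1 {zero}  {n} 0∣n = contradiction (0∣⇒≡0 0∣n) (ℕ.≢-nonZero⁻¹ n)
∣⇒≥1 {suc d} _   = s≤s z≤n

∣∧<⇒≡0 : ∀ {d n} → n ∣ d → d < n → d ≡ 0
∣∧<⇒≡0 {zero}  _   _   = refl
∣∧<⇒≡0 {suc d} n∣d d<n = contradiction (∣⇒≤ n∣d) (ℕ.<⇒≱ d<n)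

∈-divisors⁺ : ∀ {d n} .{{_ : NonZero n}} → d ∣ n → d ∈ divisors n
∈-divisors⁺ {n = n} d∣n = ∈-filter⁺ (_∣? n) (∈-range⁺ (∣⇒≥1 d∣n) (∣⇒≤ d∣n)) d∣n

∈-divisors⁻ : ∀ {d n} → d ∈ divisors n → 1 ≤ d × d ∣ n
∈-divisors⁻ {n = n} d∈ with d∈′ , d∣n ← ∈-filter⁻ (_∣? n) {xs = range n} d∈ = proj₁ (∈-range⁻ d∈′) , d∣n

unique-divisors : ∀ n → Unique (divisors n)
unique-divisors n = Unique.filter⁺ (_∣? n) (unique-range n)

primeDivisors : ℕ → List ℕ
primeDivisors n = filter prime? (divisors n)

∈-primeDivisors⁺ : ∀ {p n} .{{_ : NonZero n}} → Prime p → p ∣ n → p ∈ primeDivisors n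
∈-primeDivisors⁺ pr p∣n = ∈-filter⁺ prime? (∈-divisors⁺ p∣n) pr

∈-primeDivisors⁻ : ∀ {p n} → p ∈ primeDivisors n → Prime p × p ∣ n
∈-primeDivisors⁻ {n = n} p∈ with p∈′ , pr ← ∈-filter⁻ prime? {xs = divisors n} p∈ = pr , proj₂ (∈-divisors⁻ p∈′)

unique-primeDivisors : ∀ n → Unique (primeDivisors n)
unique-primeDivisors n = Unique.filter⁺ prime? (unique-divisors n)

quo-≡ : ∀ {n r} e → 1 ≤ e → n ≡ r ℕ.* e → n quo e ≡ r
quo-≡ {r = r} (suc e) _ refl = m*n/n≡m r (suc e)

-- Cut 1, ..., m + k m after the first block of length `m`; translation by `m` carries 1, ..., k m
-- onto the rest and preserves `P`.
count-periodic : ∀ {P : Pred ℕ 0ℓ} (P? : Decidable P) m →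
  (∀ {x} → P x → P (m ℕ.+ x)) → (∀ {x} → P (m ℕ.+ x) → P x) →
  ∀ k → length (filter P? (range (k ℕ.* m))) ≡ k ℕ.* length (filter P? (range m))
count-periodic     P? m f g zero = refl
count-periodic {P} P? m f g (suc k) = begin
  length (filter P? (range (m ℕ.+ n)))
    ≡⟨ ↭.↭-length (unique-↭ (Unique.filter⁺ P? (unique-range (m ℕ.+ n)))
         (Unique.++⁺ (Unique.filter⁺ P? (unique-range m))
           (Unique.map⁺ (ℕ.+-cancelˡ-≡ m _ _) (Unique.filter⁺ P? (unique-range n))) disjoint)
         to from) ⟩
  length (filter P? (range m) ++ map (m ℕ.+_) (filter P? (range n)))
    ≡⟨ length-++ (filter P? (range m)) ⟩
  length (filter P? (range m)) ℕ.+ length (map (m ℕ.+_) (filter P? (range n)))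
    ≡⟨ cong (length (filter P? (range m)) ℕ.+_)
         (trans (length-map _ (filter P? (range n))) (count-periodic P? m f g k)) ⟩
  length (filter P? (range m)) ℕ.+ k ℕ.* length (filter P? (range m)) ∎
  where
  open ≡-Reasoning
  n = k ℕ.* m

  disjoint : ∀ {x} → ¬ (x ∈ filter P? (range m) × x ∈ map (m ℕ.+_) (filter P? (range n)))
  disjoint (x∈ , x∈′) with y , y∈ , refl ← ∈-map⁻ (m ℕ.+_) x∈′ =
    ℕ.<⇒≱ (ℕ.m<m+n m (proj₁ (∈-range⁻ (proj₁ (∈-filter⁻ P? {xs = range n} y∈)))))
          (proj₂ (∈-range⁻ (proj₁ (∈-filter⁻ P? {xs = range m} x∈))))

  to : ∀ {x} → x ∈ filter P? (range (m ℕ.+ n)) →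
       x ∈ filter P? (range m) ++ map (m ℕ.+_) (filter P? (range n))
  to {x} x∈ with x∈′ , px ← ∈-filter⁻ P? {xs = range (m ℕ.+ n)} x∈ | x ℕ.≤? m
  ... | yes x≤m = ∈-++⁺ˡ (∈-filter⁺ P? (∈-range⁺ (proj₁ (∈-range⁻ x∈′)) x≤m) px)
  ... | no x≰m = ∈-++⁺ʳ (filter P? (range m)) (subst (_∈ map (m ℕ.+_) (filter P? (range n))) eq
    (∈-map⁺ (m ℕ.+_) (∈-filter⁺ P?
      (∈-range⁺ (ℕ.m<n⇒0<n∸m m<x) (ℕ.m≤n+o⇒m∸n≤o x m (proj₂ (∈-range⁻ x∈′))))
      (g (subst P (sym eq) px)))))
    where
    m<x = ℕ.≰⇒> x≰m
    eq : m ℕ.+ (x ∸ m) ≡ x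
    eq = ℕ.m+[n∸m]≡n (ℕ.<⇒≤ m<x)

  from : ∀ {x} → x ∈ filter P? (range m) ++ map (m ℕ.+_) (filter P? (range n)) →
         x ∈ filter P? (range (m ℕ.+ n))
  from x∈ with ∈-++⁻ (filter P? (range m)) x∈
  ... | inj₁ x∈m with x∈′ , px ← ∈-filter⁻ P? {xs = range m} x∈m with 1≤x , x≤m ← ∈-range⁻ x∈′ =
    ∈-filter⁺ P? (∈-range⁺ 1≤x (ℕ.m≤n⇒m≤n+o n x≤m)) px
  ... | inj₂ x∈n with y , y∈ , refl ← ∈-map⁻ (m ℕ.+_) x∈n
    with y∈′ , py ← ∈-filter⁻ P? {xs = range n} y∈ with 1≤y , y≤n ← ∈-range⁻ y∈′ =
    ∈-filter⁺ P? (∈-range⁺ (ℕ.m≤n⇒m≤o+n m 1≤y) (ℕ.+-monoʳ-≤ m y≤n)) (f py)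

coprime-*⁺ : ∀ {k m n} → Coprime k m → Coprime k n → Coprime k (m ℕ.* n)
coprime-*⁺ c c′ (d∣k , d∣mn) =
  c′ (d∣k , coprime-divisor (λ (e∣d , e∣m) → c (∣-trans e∣d d∣k , e∣m)) d∣mn)

coprime-∣ʳ : ∀ {k m n} → m ∣ n → Coprime k n → Coprime k m
coprime-∣ʳ m∣n c (d∣k , d∣m) = c (d∣k , ∣-trans d∣m m∣n)

module _ {p} (pr : Prime p) where
  private instance
    p≢0 = prime⇒nonZero pr

  prime-≢1 : p ≢ 1
  prime-≢1 refl = ¬prime[1] pr

  ∤⇒coprime : ∀ {k} → p ∤ k → Coprime k p
  ∤⇒coprime p∤k (d∣k , d∣p) with prime⇒irreducible pr d∣p
  ... | inj₁ d≡1  = d≡1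
  ... | inj₂ refl = contradiction d∣k p∤k

  coprime⇒∤ : ∀ {k m} → p ∣ m → Coprime k m → p ∤ k
  coprime⇒∤ p∣m c p∣k = prime-≢1 (c (p∣k , p∣m))

  private
    count-coprime : ∀ m → length (filter (λ k → coprime? k m) (range (p ℕ.* m))) ≡ p ℕ.* φ m
    count-coprime m = count-periodic (λ k → coprime? k m) m
      (λ c (d∣m+k , d∣m) → c (∣m+n∣m⇒∣n d∣m+k d∣m , d∣m))
      (λ c (d∣k , d∣m) → c (∣m∣n⇒∣m+n d∣m d∣k , d∣m)) p

  -- When p ∣ m, being coprime to p m and to m are the same condition, which has period m and is
  -- counted over p blocks.
  φ-*-∣ : ∀ {m} → p ∣ m → φ (p ℕ.* m) ≡ p ℕ.* φ m
  φ-*-∣ {m} p∣m = trans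
    (cong length (filter-≐ (λ k → coprime? k (p ℕ.* m)) (λ k → coprime? k m)
      (coprime-∣ʳ (n∣m*n p) , λ c → coprime-*⁺ (∤⇒coprime (coprime⇒∤ p∣m c)) c) (range (p ℕ.* m))))
    (count-coprime m)

  -- Of the p φ(m) numbers up to p m that are coprime to m, those divisible by p are the p y with y
  -- ≤ m coprime to m. There are φ(m) of them, and the others are coprime to p m.
  φ-*-∤ : ∀ {m} → p ∤ m → φ (p ℕ.* m) ≡ (p ∸ 1) ℕ.* φ m
  φ-*-∤ {m} p∤m = begin
    φ (p ℕ.* m)                   ≡⟨ ℕ.m+n∸n≡m _ (φ m) ⟨
    φ (p ℕ.* m) ℕ.+ φ m ∸ φ m     ≡⟨ cong (_∸ φ m) total ⟨
    p ℕ.* φ m ∸ φ m               ≡⟨ cong (p ℕ.* φ m ∸_) (ℕ.*-identityˡ (φ m)) ⟨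
    p ℕ.* φ m ∸ 1 ℕ.* φ m         ≡⟨ ℕ.*-distribʳ-∸ (φ m) p 1 ⟨
    (p ∸ 1) ℕ.* φ m               ∎
    where
    open ≡-Reasoning
    C? : ∀ n → Decidable (λ k → Coprime k n)
    C? n k = coprime? k n
    pm = p ℕ.* m
    A = filter (C? m) (range pm)
    B = filter (C? pm) (range pm)
    D = map (p ℕ.*_) (filter (C? m) (range m))

    disjoint : ∀ {x} → ¬ (x ∈ B × x ∈ D)
    disjoint (x∈B , x∈D) with y , _ , refl ← ∈-map⁻ (p ℕ.*_) x∈D =
      coprime⇒∤ (m∣m*n m) (proj₂ (∈-filter⁻ (C? pm) {xs = range pm} x∈B)) (m∣m*n y)

    to : ∀ {x} → x ∈ A → x ∈ B ++ D
    to {x} x∈A with x∈ , c ← ∈-filter⁻ (C? m) {xs = range pm} x∈A | p ∣? x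
    ... | no p∤x = ∈-++⁺ˡ (∈-filter⁺ (C? pm) x∈ (coprime-*⁺ (∤⇒coprime p∤x) c))
    ... | yes (divides y refl) with 1≤x , x≤pm ← ∈-range⁻ x∈ rewrite ℕ.*-comm y p = ∈-++⁺ʳ B
      (∈-map⁺ (p ℕ.*_) (∈-filter⁺ (C? m) (∈-range⁺ (1≤y y 1≤x) (ℕ.*-cancelˡ-≤ p x≤pm))
        (λ (d∣y , d∣m) → c (∣n⇒∣m*n p d∣y , d∣m))))
      where
      1≤y : ∀ y → 1 ≤ p ℕ.* y → 1 ≤ y
      1≤y zero 1≤ = contradiction 1≤ (subst (λ t → ¬ (1 ≤ t)) (sym (ℕ.*-zeroʳ p)) λ ())
      1≤y (suc y) _ = s≤s z≤n

    from : ∀ {x} → x ∈ B ++ D → x ∈ A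
    from x∈ with ∈-++⁻ B x∈
    ... | inj₁ x∈B with x∈′ , c ← ∈-filter⁻ (C? pm) {xs = range pm} x∈B =
      ∈-filter⁺ (C? m) x∈′ (coprime-∣ʳ (n∣m*n p) c)
    ... | inj₂ x∈D with y , y∈ , refl ← ∈-map⁻ (p ℕ.*_) x∈D
      with y∈′ , c ← ∈-filter⁻ (C? m) {xs = range m} y∈ with 1≤y , y≤m ← ∈-range⁻ y∈′ =
      ∈-filter⁺ (C? m) (∈-range⁺ (ℕ.*-mono-≤ (ℕ.>-nonZero⁻¹ p) 1≤y) (ℕ.*-monoʳ-≤ p y≤m))
        (Coprime.sym (coprime-*⁺ (∤⇒coprime p∤m) (Coprime.sym c)))

    total : p ℕ.* φ m ≡ φ pm ℕ.+ φ m
    total = begin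
      p ℕ.* φ m             ≡⟨ count-coprime m ⟨
      length A              ≡⟨ ↭.↭-length (unique-↭ (Unique.filter⁺ (C? m) (unique-range pm))
                                 (Unique.++⁺ (Unique.filter⁺ (C? pm) (unique-range pm))
                                   (Unique.map⁺ (ℕ.*-cancelˡ-≡ _ _ p) (Unique.filter⁺ (C? m) (unique-range m)))
                                   disjoint) to from) ⟩
      length (B ++ D)       ≡⟨ length-++ B ⟩
      length B ℕ.+ length D ≡⟨ cong (length B ℕ.+_) (length-map (p ℕ.*_) (filter (C? m) (range m))) ⟩
      φ pm ℕ.+ φ m          ∎

φ-nonZero : ∀ m .{{_ : NonZero m}} → NonZero (φ m)
φ-nonZero m = ℕ.>-nonZero (∈-length (∈-filter⁺ (λ k → coprime? k m)
  (∈-range⁺ {1} {m} ℕ.≤-refl (ℕ.>-nonZero⁻¹ m)) (1-coprimeTo m)))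

-- Telescoping over divisors

-- For a prime p and d > 0 this is 1 - φ(d)/φ(p d).
localFactor : ℕ → ℕ → ℚ
localFactor p d = if does (p ∣? d) then (p ∸ 1) // p else (p ∸ 2) // (p ∸ 1)

-- The coefficient of ρ(q; d) in the count, where r = φ(q)/d.
coefficient : ℕ → ℕ → ℚ
coefficient d r = (1 // φ d) * ∏ (primeDivisors r) (λ p → localFactor p d)

-- Both cases of the telescoping step have this shape: `s` is the ratio φ(p m)/φ(m), equal to p or
-- to p - 1.
split-//1 : ∀ s a .{{_ : NonZero s}} .{{_ : NonZero a}} →
            (1 // (s ℕ.* a)) + ((s ∸ 1) // s) * (1 // a) ≡ 1 // a
split-//1 (suc s) a = begin
  (1 // (suc s ℕ.* a)) + (s // suc s) * (1 // a)
    ≡⟨ cong ((1 // (suc s ℕ.* a)) +_) (//-* s (suc s) 1 a) ⟩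
  (1 // (suc s ℕ.* a)) + ((s ℕ.* 1) // (suc s ℕ.* a))
    ≡⟨ //-+ 1 (s ℕ.* 1) (suc s ℕ.* a) {{sa≢0}} ⟩
  suc (s ℕ.* 1) // (suc s ℕ.* a)
    ≡⟨ //-cross (suc (s ℕ.* 1)) (suc s ℕ.* a) 1 a {{sa≢0}} eq ⟩
  1 // a ∎
  where
  open ≡-Reasoning
  sa≢0 : NonZero (suc s ℕ.* a)
  sa≢0 = ℕ.m*n≢0 (suc s) a
  eq : suc (s ℕ.* 1) ℕ.* a ≡ 1 ℕ.* (suc s ℕ.* a)
  eq rewrite ℕ.*-identityʳ s = sym (ℕ.*-identityˡ _)

module _ {p} (pr : Prime p) where
  private instance
    p≢0 = prime⇒nonZero pr
    p∸1≢0 : NonZero (p ∸ 1)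
    p∸1≢0 = ℕ.>-nonZero (ℕ.m<n⇒0<n∸m (ℕ.nonTrivial⇒n>1 p {{prime⇒nonTrivial pr}}))

  localFactor-telescope : ∀ m .{{_ : NonZero m}} →
    (1 // φ (p ℕ.* m)) + localFactor p m * (1 // φ m) ≡ 1 // φ m
  localFactor-telescope m with p ∣? m
  ... | yes p∣m rewrite φ-*-∣ pr p∣m = split-//1 p (φ m) {{p≢0}} {{φ-nonZero m}}
  ... | no p∤m rewrite φ-*-∤ pr p∤m | sym (ℕ.∸-+-assoc p 1 1) = split-//1 (p ∸ 1) (φ m) {{p∸1≢0}} {{φ-nonZero m}}

  private
    RemovedPower : ℕ → Set
    RemovedPower k = ∃[ a ] ∃[ k′ ] (NonZero k′ × p ∤ k′ × k ≡ p ^ a ℕ.* k′)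

  -- The divisors of k that p does not divide are the divisors of the p-free part k′. Dividing by p
  -- only once would not isolate them.
  removePower : ∀ k .{{_ : NonZero k}} → RemovedPower k
  removePower k {{k≢0}} = <-rec (λ k → .(NonZero k) → RemovedPower k) step k k≢0
    where
    step : ∀ k → (∀ {j} → j < k → .(NonZero j) → RemovedPower j) → .(NonZero k) → RemovedPower k
    step zero rec ()
    step k@(suc _) rec _ with p ∣? k
    ... | no p∤k = 0 , k , _ , p∤k , sym (ℕ.*-identityˡ k)
    ... | yes (divides j@(suc _) k≡jp) with a , k′ , k′≢0 , p∤k′ , j≡ ← rec {j}
                  (subst (j <_) (sym k≡jp) (ℕ.m<m*n j p (ℕ.nonTrivial⇒n>1 p {{prime⇒nonTrivial pr}}))) _ =
      suc a , k′ , k′≢0 , p∤k′ ,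
      trans k≡jp (trans (ℕ.*-comm j p) (trans (cong (p ℕ.*_) j≡) (sym (ℕ.*-assoc p (p ^ a) k′))))

  prime-∣-^ : ∀ {r} a → Prime r → r ∣ p ^ a → r ≡ p
  prime-∣-^ zero    rr r∣1 = contradiction (∣1⇒≡1 r∣1) (prime-≢1 rr)
  prime-∣-^ (suc a) rr r∣ with euclidsLemma p (p ^ a) rr r∣
  ... | inj₂ r∣p^a = prime-∣-^ a rr r∣p^a
  ... | inj₁ r∣p with prime⇒irreducible pr r∣p
  ...   | inj₁ r≡1 = contradiction r≡1 (prime-≢1 rr)
  ...   | inj₂ r≡p = r≡p

  -- However high the power of p, it is listed once among the prime divisors, so it contributes a
  -- single factor.
  ∏-primeDivisors-^ : ∀ a r .{{_ : NonZero r}} → p ∤ r → (f : ℕ → ℚ) →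
    ∏ (primeDivisors (p ^ suc a ℕ.* r)) f ≡ f p * ∏ (primeDivisors r) f
  ∏-primeDivisors-^ a r p∤r f = ∏-↭ f (unique-↭ (unique-primeDivisors (p ^ suc a ℕ.* r)) (All.tabulate
    (λ x∈ p≡x → p∤r (subst (_∣ r) (sym p≡x) (proj₂ (∈-primeDivisors⁻ {n = r} x∈)))) ∷ unique-primeDivisors r)
    to from)
    where
    instance
      p^a≢0 = ℕ.m^n≢0 p (suc a)
      nz = ℕ.m*n≢0 (p ^ suc a) r
    to : ∀ {x} → x ∈ primeDivisors (p ^ suc a ℕ.* r) → x ∈ p ∷ primeDivisors r
    to x∈ with xr , x∣ ← ∈-primeDivisors⁻ {n = p ^ suc a ℕ.* r} x∈ with euclidsLemma (p ^ suc a) r xr x∣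
    ... | inj₁ x∣p^a = here (prime-∣-^ (suc a) xr x∣p^a)
    ... | inj₂ x∣r   = there (∈-primeDivisors⁺ xr x∣r)
    from : ∀ {x} → x ∈ p ∷ primeDivisors r → x ∈ primeDivisors (p ^ suc a ℕ.* r)
    from (here refl) = ∈-primeDivisors⁺ pr (∣m⇒∣m*n r (m∣m*n (p ^ a)))
    from (there x∈) with xr , x∣r ← ∈-primeDivisors⁻ {n = r} x∈ = ∈-primeDivisors⁺ xr (∣n⇒∣m*n (p ^ suc a) x∣r)

  localFactor-*-∤ : ∀ {e} m → p ∤ e → localFactor p (e ℕ.* m) ≡ localFactor p m
  localFactor-*-∤ {e} m p∤e = if-⇔ (p ∣? (e ℕ.* m)) (p ∣? m)
    (λ p∣em → [ (λ p∣e → contradiction p∣e p∤e) , (λ z → z) ]′ (euclidsLemma e m pr p∣em)) (∣n⇒∣m*n e)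

∣-*-quo : ∀ {e k} → e ∈ divisors k → ∃[ r ] (k ≡ r ℕ.* e × k quo e ≡ r)
∣-*-quo {e} {k} e∈ with 1≤e , divides r eq ← ∈-divisors⁻ {n = k} e∈ = r , eq , quo-≡ e 1≤e eq

quo-* : ∀ {e k} → e ∈ divisors k → k ≡ (k quo e) ℕ.* e
quo-* {e} {k} e∈ with r , k≡re , quo≡ ← ∣-*-quo {k = k} e∈ = trans k≡re (cong (ℕ._* e) (sym quo≡))

-- Strong induction on `k` for all `m` at once, splitting the divisors e of `k` by a prime p ∣ k.
-- For e = p e′ the factor p moves into `m`, and these terms add up to 1/φ(p m). The other e divide
-- the p-free part of `k`, and p divides all their cofactors. Since f(p, e m) depends only on
-- whether p ∣ e m, it equals f(p, m) and can be pulled out, which leaves f(p, m)/φ(m). The two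
-- parts add up to 1/φ(m) by the choice of f.
coefficient-sum : ∀ k m .{{_ : NonZero k}} .{{_ : NonZero m}} →
  ∑[ e ∈ divisors k ] coefficient (e ℕ.* m) (k quo e) ≡ 1 // φ m
coefficient-sum k m {{k≢0}} {{m≢0}} = <-rec Goal step k k≢0 m m≢0
  where
  Goal : ℕ → Set
  Goal k = .(NonZero k) → ∀ m → .(NonZero m) →
    ∑[ e ∈ divisors k ] coefficient (e ℕ.* m) (k quo e) ≡ 1 // φ m

  step : ∀ k → (∀ {j} → j < k → Goal j) → Goal k
  step k rec k≢0 m m≢0 with factorise k {{k≢0}}
  -- No prime factors: k = 1, and the only term is e = 1 with an empty product.
  ... | record { factors = [] ; isFactorisation = refl } = begin
    coefficient (1 ℕ.* m) 1 + 0ℚ ≡⟨ ℚ.+-identityʳ _ ⟩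
    (1 // φ (1 ℕ.* m)) * 1ℚ      ≡⟨ ℚ.*-identityʳ _ ⟩
    1 // φ (1 ℕ.* m)             ≡⟨ cong (λ t → 1 // φ t) (ℕ.*-identityˡ m) ⟩
    1 // φ m                     ∎
    where open ≡-Reasoning
  ... | record { factors = p ∷ ps ; isFactorisation = refl ; factorsPrime = pr All.∷ prs } = begin
    ∑ (divisors pj) F
      ≡⟨ ∑-split (p ∣?_) (divisors pj) F ⟩
    ∑ (filter (p ∣?_) (divisors pj)) F + ∑ (filter (¬? ∘ (p ∣?_)) (divisors pj)) F
      ≡⟨ cong₂ _+_ multiples nonmultiples ⟩
    (1 // φ (p ℕ.* m)) + localFactor p m * (1 // φ m)
      ≡⟨ localFactor-telescope pr m ⟩
    1 // φ m ∎
    where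
    open ≡-Reasoning
    j = product ps
    pj = p ℕ.* j
    F : ℕ → ℚ
    F e = coefficient (e ℕ.* m) (pj quo e)

    instance
      m≢0′ : NonZero m
      m≢0′ = ℕ.≢-nonZero (ℕ.≢-nonZero⁻¹ m {{m≢0}})
      p≢0 : NonZero p
      p≢0 = prime⇒nonZero pr
      pj≢0 : NonZero pj
      pj≢0 = ℕ.≢-nonZero (ℕ.≢-nonZero⁻¹ pj {{k≢0}})
      j≢0 : NonZero j
      j≢0 = ℕ.m*n≢0⇒n≢0 p
      pm≢0 : NonZero (p ℕ.* m)
      pm≢0 = ℕ.m*n≢0 p m

    j<pj : j < pj
    j<pj = subst (j <_) (ℕ.*-comm j p) (ℕ.m<m*n j p (ℕ.nonTrivial⇒n>1 p {{prime⇒nonTrivial pr}}))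

    multiples : ∑ (filter (p ∣?_) (divisors pj)) F ≡ 1 // φ (p ℕ.* m)
    multiples = begin
      ∑ (filter (p ∣?_) (divisors pj)) F
        ≡⟨ ∑-↭ F (unique-↭ (Unique.filter⁺ (p ∣?_) (unique-divisors pj))
             (Unique.map⁺ (ℕ.*-cancelˡ-≡ _ _ p) (unique-divisors j)) to from) ⟩
      ∑ (map (p ℕ.*_) (divisors j)) F
        ≡⟨ ∑-map (p ℕ.*_) (divisors j) F ⟩
      ∑ (divisors j) (λ e → F (p ℕ.* e))
        ≡⟨ ∑-cong (divisors j) reindex ⟩
      ∑ (divisors j) (λ e → coefficient (e ℕ.* (p ℕ.* m)) (j quo e))
        ≡⟨ rec j<pj j≢0 (p ℕ.* m) pm≢0 ⟩
      1 // φ (p ℕ.* m) ∎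
      where
      to : ∀ {x} → x ∈ filter (p ∣?_) (divisors pj) → x ∈ map (p ℕ.*_) (divisors j)
      to {x} x∈ with x∈′ , divides e refl ← ∈-filter⁻ (p ∣?_) {xs = divisors pj} x∈ =
        subst (_∈ map (p ℕ.*_) (divisors j)) (ℕ.*-comm p e) (∈-map⁺ (p ℕ.*_) (∈-divisors⁺
          (*-cancelˡ-∣ p (subst (_∣ pj) (ℕ.*-comm e p) (proj₂ (∈-divisors⁻ {n = pj} x∈′))))))
      from : ∀ {x} → x ∈ map (p ℕ.*_) (divisors j) → x ∈ filter (p ∣?_) (divisors pj)
      from x∈ with e , e∈ , refl ← ∈-map⁻ (p ℕ.*_) x∈ =
        ∈-filter⁺ (p ∣?_) (∈-divisors⁺ (*-monoʳ-∣ p (proj₂ (∈-divisors⁻ {n = j} e∈)))) (m∣m*n e)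
      reindex : ∀ {e} → e ∈ divisors j → F (p ℕ.* e) ≡ coefficient (e ℕ.* (p ℕ.* m)) (j quo e)
      reindex {e} e∈ with r , j≡re , quo≡ ← ∣-*-quo {k = j} e∈ = cong₂ coefficient
        (trans (cong (ℕ._* m) (ℕ.*-comm p e)) (ℕ.*-assoc e p m))
        (trans (quo-≡ (p ℕ.* e) (ℕ.*-mono-≤ (ℕ.>-nonZero⁻¹ p) (proj₁ (∈-divisors⁻ {n = j} e∈)))
          (trans (cong (p ℕ.*_) (trans j≡re (ℕ.*-comm r e)))
            (trans (sym (ℕ.*-assoc p e r)) (ℕ.*-comm (p ℕ.* e) r))))
          (sym quo≡))

    nonmultiples : ∑ (filter (¬? ∘ (p ∣?_)) (divisors pj)) F ≡ localFactor p m * (1 // φ m)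
    nonmultiples with a , k , k≢0 , p∤k , j≡ ← removePower pr j = begin
      ∑ (filter (¬? ∘ (p ∣?_)) (divisors pj)) F
        ≡⟨ ∑-↭ F (unique-↭ (Unique.filter⁺ (¬? ∘ (p ∣?_)) (unique-divisors pj)) (unique-divisors k) to from) ⟩
      ∑ (divisors k) F
        ≡⟨ ∑-cong (divisors k) factor ⟩
      ∑ (divisors k) (λ e → localFactor p m * coefficient (e ℕ.* m) (k quo e))
        ≡⟨ *-distribˡ-∑ (localFactor p m) (divisors k) _ ⟨
      localFactor p m * ∑ (divisors k) (λ e → coefficient (e ℕ.* m) (k quo e))
        ≡⟨ cong (localFactor p m *_) (rec k<pj k≢0 m m≢0) ⟩
      localFactor p m * (1 // φ m) ∎
      where
      instance
        k≢0′ : NonZero k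
        k≢0′ = k≢0
      pj≡ : pj ≡ p ^ suc a ℕ.* k
      pj≡ = trans (cong (p ℕ.*_) j≡) (sym (ℕ.*-assoc p (p ^ a) k))
      k<pj : k < pj
      k<pj = ℕ.≤-<-trans (∣⇒≤ (divides (p ^ a) j≡)) j<pj
      to : ∀ {x} → x ∈ filter (¬? ∘ (p ∣?_)) (divisors pj) → x ∈ divisors k
      to {x} x∈ with x∈′ , p∤x ← ∈-filter⁻ (¬? ∘ (p ∣?_)) {xs = divisors pj} x∈ =
        ∈-divisors⁺ (go (suc a) (subst (x ∣_) pj≡ (proj₂ (∈-divisors⁻ {n = pj} x∈′))))
        where
        -- As x is coprime to p, the factors p are stripped off one by one.
        go : ∀ b → x ∣ p ^ b ℕ.* k → x ∣ k
        go zero    x∣ = subst (x ∣_) (ℕ.*-identityˡ k) x∣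
        go (suc b) x∣ = go b (coprime-divisor (∤⇒coprime pr p∤x) (subst (x ∣_) (ℕ.*-assoc p (p ^ b) k) x∣))
      from : ∀ {x} → x ∈ divisors k → x ∈ filter (¬? ∘ (p ∣?_)) (divisors pj)
      from {x} x∈ with _ , x∣k ← ∈-divisors⁻ {n = k} x∈ =
        ∈-filter⁺ (¬? ∘ (p ∣?_)) (∈-divisors⁺ (subst (x ∣_) (sym pj≡) (∣n⇒∣m*n (p ^ suc a) x∣k)))
          (λ p∣x → p∤k (∣-trans p∣x x∣k))
      factor : ∀ {e} → e ∈ divisors k → F e ≡ localFactor p m * coefficient (e ℕ.* m) (k quo e)
      factor {e} e∈ with 1≤e , e∣k ← ∈-divisors⁻ {n = k} e∈ | r , k≡re , quo≡ ← ∣-*-quo {k = k} e∈ = begin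
        -- With r = k/e, the cofactor of e in p j is p^(a+1) r with p not dividing r. Its prime
        -- divisors are those of r together with p.
        coefficient (e ℕ.* m) (pj quo e)
          ≡⟨ cong (coefficient (e ℕ.* m)) (quo-≡ {r = p ^ suc a ℕ.* r} e 1≤e
               (trans pj≡ (trans (cong (p ^ suc a ℕ.*_) k≡re) (sym (ℕ.*-assoc (p ^ suc a) r e))))) ⟩
        w * ∏ (primeDivisors (p ^ suc a ℕ.* r)) f
          ≡⟨ cong (w *_) (∏-primeDivisors-^ pr a r {{r≢0}}
               (λ p∣r → p∤k (subst (p ∣_) (sym k≡re) (∣m⇒∣m*n e p∣r))) f) ⟩
        w * (f p * ∏ (primeDivisors r) f)
          ≡⟨ ℚ.*-assoc w (f p) _ ⟨
        w * f p * ∏ (primeDivisors r) f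
          ≡⟨ cong (_* ∏ (primeDivisors r) f) (ℚ.*-comm w (f p)) ⟩
        f p * w * ∏ (primeDivisors r) f
          ≡⟨ ℚ.*-assoc (f p) w _ ⟩
        f p * coefficient (e ℕ.* m) r
          ≡⟨ cong₂ (λ s t → s * coefficient (e ℕ.* m) t)
               (localFactor-*-∤ pr m (λ p∣e → p∤k (∣-trans p∣e e∣k))) (sym quo≡) ⟩
        localFactor p m * coefficient (e ℕ.* m) (k quo e) ∎
        where
        w = 1 // φ (e ℕ.* m)
        f = λ p′ → localFactor p′ (e ℕ.* m)
        r≢0 : NonZero r
        r≢0 = ℕ.m*n≢0⇒m≢0 r {{subst NonZero k≡re k≢0}}

-- From the coefficients to products over odd primes

∈-oddPrimeDivisors⁺ : ∀ {p n} .{{_ : NonZero n}} → Prime p → p ≢ 2 → p ∣ n → p ∈ oddPrimeDivisors n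
∈-oddPrimeDivisors⁺ pr p≢2 p∣n = ∈-filter⁺ (λ p → prime? p ×-dec ¬? (p ℕ.≟ 2)) (∈-divisors⁺ p∣n) (pr , p≢2)

∈-oddPrimeDivisors⁻ : ∀ {p n} → p ∈ oddPrimeDivisors n → Prime p × p ≢ 2 × p ∣ n
∈-oddPrimeDivisors⁻ {n = n} p∈
  with p∈′ , pr , p≢2 ← ∈-filter⁻ (λ p → prime? p ×-dec ¬? (p ℕ.≟ 2)) {xs = divisors n} p∈ =
  pr , p≢2 , proj₂ (∈-divisors⁻ {n = n} p∈′)

unique-oddPrimeDivisors : ∀ n → Unique (oddPrimeDivisors n)
unique-oddPrimeDivisors n = Unique.filter⁺ (λ p → prime? p ×-dec ¬? (p ℕ.≟ 2)) (unique-divisors n)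

-- This brings the products over the primes of d and of n/d to the common index set of odd primes of
-- `n`, where they can be compared factor by factor.
∏-oddPrimeDivisors-extend : ∀ {d n} .{{_ : NonZero d}} .{{_ : NonZero n}} → d ∣ n → (f : ℕ → ℚ) →
  ∏ (oddPrimeDivisors d) f ≡ ∏ (oddPrimeDivisors n) (λ p → if does (p ∣? d) then f p else 1ℚ)
∏-oddPrimeDivisors-extend {d} {n} d∣n f = trans
  (∏-↭ f (unique-↭ (unique-oddPrimeDivisors d) (Unique.filter⁺ (_∣? d) (unique-oddPrimeDivisors n)) to from))
  (∏-filter (_∣? d) (oddPrimeDivisors n) f)
  where
  to : ∀ {p} → p ∈ oddPrimeDivisors d → p ∈ filter (_∣? d) (oddPrimeDivisors n)
  to p∈ with pr , p≢2 , p∣d ← ∈-oddPrimeDivisors⁻ {n = d} p∈ =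
    ∈-filter⁺ (_∣? d) (∈-oddPrimeDivisors⁺ pr p≢2 (∣-trans p∣d d∣n)) p∣d
  from : ∀ {p} → p ∈ filter (_∣? d) (oddPrimeDivisors n) → p ∈ oddPrimeDivisors d
  from p∈ with p∈′ , p∣d ← ∈-filter⁻ (_∣? d) {xs = oddPrimeDivisors n} p∈
    with pr , p≢2 , _ ← ∈-oddPrimeDivisors⁻ {n = n} p∈′ = ∈-oddPrimeDivisors⁺ pr p≢2 p∣d

∏-primeDivisors-2∣ : ∀ {n} .{{_ : NonZero n}} → 2 ∣ n → (f : ℕ → ℚ) →
  ∏ (primeDivisors n) f ≡ f 2 * ∏ (oddPrimeDivisors n) f
∏-primeDivisors-2∣ {n} 2∣n f = ∏-↭ f (unique-↭ (unique-primeDivisors n)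
  (All.tabulate (λ p∈ 2≡p → proj₁ (proj₂ (∈-oddPrimeDivisors⁻ {n = n} p∈)) (sym 2≡p)) ∷ unique-oddPrimeDivisors n)
  to from)
  where
  to : ∀ {p} → p ∈ primeDivisors n → p ∈ 2 ∷ oddPrimeDivisors n
  to {p} p∈ with pr , p∣n ← ∈-primeDivisors⁻ {n = n} p∈ | p ℕ.≟ 2
  ... | yes refl = here refl
  ... | no p≢2   = there (∈-oddPrimeDivisors⁺ pr p≢2 p∣n)
  from : ∀ {p} → p ∈ 2 ∷ oddPrimeDivisors n → p ∈ primeDivisors n
  from (here refl) = ∈-primeDivisors⁺ prime[2] 2∣n
  from (there p∈) with pr , _ , p∣n ← ∈-oddPrimeDivisors⁻ {n = n} p∈ = ∈-primeDivisors⁺ pr p∣n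

∏-primeDivisors-2∤ : ∀ {n} .{{_ : NonZero n}} → 2 ∤ n → (f : ℕ → ℚ) →
  ∏ (primeDivisors n) f ≡ ∏ (oddPrimeDivisors n) f
∏-primeDivisors-2∤ {n} 2∤n f = ∏-↭ f (unique-↭ (unique-primeDivisors n) (unique-oddPrimeDivisors n)
  (λ p∈ → let pr , p∣n = ∈-primeDivisors⁻ {n = n} p∈ in
    ∈-oddPrimeDivisors⁺ pr (λ p≡2 → 2∤n (subst (_∣ n) p≡2 p∣n)) p∣n)
  (λ p∈ → let pr , _ , p∣n = ∈-oddPrimeDivisors⁻ {n = n} p∈ in ∈-primeDivisors⁺ pr p∣n))

-- With p = 3 + t this is (p - 2)/(p - 1) · (p - 1)²/(p (p - 2)) = (p - 1)/p. The substitution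
-- removes truncated subtraction and makes all denominators visibly positive.
localFactor-∣ : ∀ t → ((1 ℕ.+ t) // (2 ℕ.+ t)) * (((2 ℕ.+ t) ^ 2) // ((3 ℕ.+ t) ℕ.* (1 ℕ.+ t)))
                    ≡ (2 ℕ.+ t) // (3 ℕ.+ t)
localFactor-∣ t = trans (//-* (1 ℕ.+ t) (2 ℕ.+ t) ((2 ℕ.+ t) ^ 2) ((3 ℕ.+ t) ℕ.* (1 ℕ.+ t)))
  (//-cross ((1 ℕ.+ t) ℕ.* (2 ℕ.+ t) ^ 2) ((2 ℕ.+ t) ℕ.* ((3 ℕ.+ t) ℕ.* (1 ℕ.+ t))) (2 ℕ.+ t) (3 ℕ.+ t) (eq t))
  where
  eq : ∀ t → (1 ℕ.+ t) ℕ.* ((2 ℕ.+ t) ℕ.* ((2 ℕ.+ t) ℕ.* 1)) ℕ.* (3 ℕ.+ t)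
           ≡ (2 ℕ.+ t) ℕ.* ((2 ℕ.+ t) ℕ.* ((3 ℕ.+ t) ℕ.* (1 ℕ.+ t)))
  eq = solve-∀

-- At b = 0 both sides are 0 by the default value of `_//_`.
//-pullˡ : ∀ a b → a // b ≡ (a // 1) * (1 // b)
//-pullˡ a zero    = sym (ℚ.*-zeroʳ (a // 1))
//-pullˡ a b@(suc _) = sym (trans (//-* a 1 1 b) (cong₂ _//_ (ℕ.*-identityʳ a) (ℕ.*-identityˡ b)))

private
  -- The correction at a single odd prime p = 3 + t, with the two divisibilities as Booleans. The
  -- case that p divides neither d nor r is excluded, since p divides n = r d.
  local-identity : ∀ t (p∣d p∣r : Bool) → p∣d ≡ true ⊎ p∣r ≡ true → let p = 3 ℕ.+ t in
    ((p ∸ 2) // (p ∸ 1)) *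
      ((if p∣d then (if p∣r then ((p ∸ 1) ^ 2) // (p ℕ.* (p ∸ 2)) else 1ℚ) else 1ℚ) *
       (if p∣d then (if not p∣r then (p ∸ 1) // (p ∸ 2) else 1ℚ) else 1ℚ))
    ≡ (if p∣r then (if p∣d then (p ∸ 1) // p else (p ∸ 2) // (p ∸ 1)) else 1ℚ)
  local-identity t true  true  _ = trans
    (cong (((1 ℕ.+ t) // (2 ℕ.+ t)) *_) (ℚ.*-identityʳ _)) (localFactor-∣ t)
  local-identity t true  false _ = trans
    (cong (((1 ℕ.+ t) // (2 ℕ.+ t)) *_) (ℚ.*-identityˡ _)) (m//n*n//m≡1 (1 ℕ.+ t) (2 ℕ.+ t))
  local-identity t false true  _ = ℚ.*-identityʳ _
  local-identity t false false (inj₁ ())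
  local-identity t false false (inj₂ ())

module _ {n d r : ℕ} .{{n≢0 : NonZero n}} (n≡rd : n ≡ r ℕ.* d) where
  private
    instance
      rd≢0 : NonZero (r ℕ.* d)
      rd≢0 = subst NonZero n≡rd (ℕ.≢-nonZero (ℕ.≢-nonZero⁻¹ n))
      r≢0 : NonZero r
      r≢0 = ℕ.m*n≢0⇒m≢0 r
      d≢0 : NonZero d
      d≢0 = ℕ.m*n≢0⇒n≢0 r
    g α β α′ β′ : ℕ → ℚ
    g p = (p ∸ 2) // (p ∸ 1)
    α p = ((p ∸ 1) ^ 2) // (p ℕ.* (p ∸ 2))
    β p = (p ∸ 1) // (p ∸ 2)
    α′ p = if does (p ∣? d) then (if does (p ∣? r) then α p else 1ℚ) else 1ℚ
    β′ p = if does (p ∣? d) then (if does (¬? (p ∣? r)) then β p else 1ℚ) else 1ℚ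

    pointwise : ∀ {p} → Prime p → p ≢ 2 → p ∣ n →
      g p * (α′ p * β′ p) ≡ (if does (p ∣? r) then localFactor p d else 1ℚ)
    pointwise {0} pr p≢2 p∣n = contradiction pr ¬prime[0]
    pointwise {1} pr p≢2 p∣n = contradiction pr ¬prime[1]
    pointwise {2} pr p≢2 p∣n = contradiction refl p≢2
    pointwise {p@(suc (suc (suc t)))} pr p≢2 p∣n = local-identity t (does (p ∣? d)) (does (p ∣? r))
      (Sum.swap (Sum.map (dec-true (p ∣? r)) (dec-true (p ∣? d)) (euclidsLemma r d pr (subst (p ∣_) n≡rd p∣n))))

  ∏-localFactor : ∏ (oddPrimeDivisors n) g *
      (∏ (filter (_∣? r) (oddPrimeDivisors d)) α * ∏ (filter (λ p → ¬? (p ∣? r)) (oddPrimeDivisors d)) β)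
    ≡ ∏ (oddPrimeDivisors r) (λ p → localFactor p d)
  ∏-localFactor = begin
    ∏ X g * (∏ (filter (_∣? r) Y) α * ∏ (filter (λ p → ¬? (p ∣? r)) Y) β)
      ≡⟨ cong₂ (λ s t → ∏ X g * (s * t))
           (trans (∏-filter (_∣? r) Y α) (∏-oddPrimeDivisors-extend d∣n _))
           (trans (∏-filter (λ p → ¬? (p ∣? r)) Y β) (∏-oddPrimeDivisors-extend d∣n _)) ⟩
    ∏ X g * (∏ X α′ * ∏ X β′)
      ≡⟨ cong (∏ X g *_) (∏-* X α′ β′) ⟨
    ∏ X g * ∏ X (λ p → α′ p * β′ p)
      ≡⟨ ∏-* X g (λ p → α′ p * β′ p) ⟨
    ∏ X (λ p → g p * (α′ p * β′ p))
      ≡⟨ ∏-cong X (λ p∈ → let pr , p≢2 , p∣n = ∈-oddPrimeDivisors⁻ {n = n} p∈ in pointwise pr p≢2 p∣n) ⟩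
    ∏ X (λ p → if does (p ∣? r) then localFactor p d else 1ℚ)
      ≡⟨ ∏-oddPrimeDivisors-extend r∣n (λ p → localFactor p d) ⟨
    ∏ (oddPrimeDivisors r) (λ p → localFactor p d) ∎
    where
    open ≡-Reasoning
    X = oddPrimeDivisors n
    Y = oddPrimeDivisors d
    d∣n : d ∣ n
    d∣n = divides r n≡rd
    r∣n : r ∣ n
    r∣n = divides d (trans n≡rd (ℕ.*-comm r d))

  -- For even d the local factor at 2 is (2 - 1)/2, and it is present exactly when 2 ∣ r; this is
  -- the guarded 1/2 of the formula.
  localFactor-2 : 2 ∣ d → ∏ (oddPrimeDivisors r) (λ p → localFactor p d) *
      (if ⌊ (2 ∣? d) ×-dec (2 ∣? r) ⌋ then ½ else 1ℚ) ≡ ∏ (primeDivisors r) (λ p → localFactor p d)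
  localFactor-2 2∣d = trans (cong (∏ (oddPrimeDivisors r) f *_) guard) (go (2 ∣? r))
    where
    f = λ p → localFactor p d
    guard : (if ⌊ (2 ∣? d) ×-dec (2 ∣? r) ⌋ then ½ else 1ℚ) ≡ (if does (2 ∣? r) then ½ else 1ℚ)
    guard = cong (if_then ½ else 1ℚ)
      (trans (isYes≗does ((2 ∣? d) ×-dec (2 ∣? r))) (cong (_∧ does (2 ∣? r)) (dec-true (2 ∣? d) 2∣d)))
    go : Dec (2 ∣ r) → ∏ (oddPrimeDivisors r) f * (if does (2 ∣? r) then ½ else 1ℚ) ≡ ∏ (primeDivisors r) f
    go (no 2∤r) = begin
      ∏ (oddPrimeDivisors r) f * (if does (2 ∣? r) then ½ else 1ℚ)
        ≡⟨ cong (∏ (oddPrimeDivisors r) f *_) (if-no (2 ∣? r) 2∤r) ⟩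
      ∏ (oddPrimeDivisors r) f * 1ℚ ≡⟨ ℚ.*-identityʳ _ ⟩
      ∏ (oddPrimeDivisors r) f      ≡⟨ ∏-primeDivisors-2∤ 2∤r f ⟨
      ∏ (primeDivisors r) f         ∎
      where open ≡-Reasoning
    go (yes 2∣r) = begin
      ∏ (oddPrimeDivisors r) f * (if does (2 ∣? r) then ½ else 1ℚ)
        ≡⟨ cong (∏ (oddPrimeDivisors r) f *_) (if-yes (2 ∣? r) 2∣r) ⟩
      ∏ (oddPrimeDivisors r) f * ½    ≡⟨ ℚ.*-comm (∏ (oddPrimeDivisors r) f) ½ ⟩
      ½ * ∏ (oddPrimeDivisors r) f    ≡⟨ cong (_* ∏ (oddPrimeDivisors r) f) (if-yes (2 ∣? d) 2∣d) ⟨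
      f 2 * ∏ (oddPrimeDivisors r) f  ≡⟨ ∏-primeDivisors-2∣ 2∣r f ⟨
      ∏ (primeDivisors r) f           ∎
      where open ≡-Reasoning

  coefficient-factors : 2 ∣ d → ∀ a → ∏ (oddPrimeDivisors n) g *
      ((a // φ d) * ∏ (filter (_∣? r) (oddPrimeDivisors d)) α
                  * ∏ (filter (λ p → ¬? (p ∣? r)) (oddPrimeDivisors d)) β
                  * (if ⌊ (2 ∣? d) ×-dec (2 ∣? r) ⌋ then ½ else 1ℚ))
    ≡ (a // 1) * coefficient d r
  coefficient-factors 2∣d a = begin
    G * ((a // φ d) * A * B * I)      ≡⟨ cong (λ t → G * (t * A * B * I)) (//-pullˡ a (φ d)) ⟩
    G * (ι * w * A * B * I)           ≡⟨ rearrange G ι w A B I ⟩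
    ι * (w * (G * (A * B) * I))       ≡⟨ cong (λ t → ι * (w * (t * I))) ∏-localFactor ⟩
    ι * (w * (∏ (oddPrimeDivisors r) (λ p → localFactor p d) * I))
                                      ≡⟨ cong (λ t → ι * (w * t)) (localFactor-2 2∣d) ⟩
    ι * coefficient d r               ∎
    where
    open ≡-Reasoning
    ι = a // 1
    w = 1 // φ d
    G = ∏ (oddPrimeDivisors n) g
    A = ∏ (filter (_∣? r) (oddPrimeDivisors d)) α
    B = ∏ (filter (λ p → ¬? (p ∣? r)) (oddPrimeDivisors d)) β
    I = if ⌊ (2 ∣? d) ×-dec (2 ∣? r) ⌋ then ½ else 1ℚ
    rearrange : ∀ G ι w A B I → G * (ι * w * A * B * I) ≡ ι * (w * (G * (A * B) * I))
    rearrange G ι w A B I = begin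
      G * (ι * w * A * B * I)     ≡⟨ cong (λ t → G * (t * I)) (ℚ.*-assoc (ι * w) A B) ⟩
      G * (ι * w * (A * B) * I)   ≡⟨ cong (G *_) (ℚ.*-assoc (ι * w) (A * B) I) ⟩
      G * (ι * w * (A * B * I))   ≡⟨ ℚ.*-assoc G (ι * w) _ ⟨
      G * (ι * w) * (A * B * I)   ≡⟨ cong (_* (A * B * I)) (ℚ.*-comm G (ι * w)) ⟩
      ι * w * G * (A * B * I)     ≡⟨ ℚ.*-assoc (ι * w) G _ ⟩
      ι * w * (G * (A * B * I))   ≡⟨ cong (ι * w *_) (ℚ.*-assoc G (A * B) I) ⟨
      ι * w * (G * (A * B) * I)   ≡⟨ ℚ.*-assoc ι w _ ⟩
      ι * (w * (G * (A * B) * I)) ∎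

coefficient-odd : ∀ {d r} .{{_ : NonZero r}} → 2 ∤ d → 2 ∣ r → coefficient d r ≡ 0ℚ
coefficient-odd {d} {r} 2∤d 2∣r = begin
  (1 // φ d) * ∏ (primeDivisors r) f
    ≡⟨ cong ((1 // φ d) *_) (∏-primeDivisors-2∣ 2∣r f) ⟩
  (1 // φ d) * (f 2 * ∏ (oddPrimeDivisors r) f)
    ≡⟨ cong (λ t → (1 // φ d) * (t * ∏ (oddPrimeDivisors r) f)) (if-no (2 ∣? d) 2∤d) ⟩
  (1 // φ d) * (0ℚ * ∏ (oddPrimeDivisors r) f)
    ≡⟨ cong ((1 // φ d) *_) (ℚ.*-zeroˡ (∏ (oddPrimeDivisors r) f)) ⟩
  (1 // φ d) * 0ℚ
    ≡⟨ ℚ.*-zeroʳ (1 // φ d) ⟩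
  0ℚ ∎
  where
  open ≡-Reasoning
  f = λ p → localFactor p d

-- Cyclic subgroups of a finite abelian group

leastWitness : ∀ {P : Pred ℕ p} → Decidable P → ∀ n → P n →
               ∃[ m ] (P m × (∀ {k} → k < m → ¬ P k))
leastWitness P? n pn with P? 0
... | yes p0 = 0 , p0 , λ ()
leastWitness P? zero pn | no ¬p0 = contradiction pn ¬p0
leastWitness {P = P} P? (suc n) pn | no ¬p0 with m , pm , min ← leastWitness (P? ∘ suc) n pn =
  suc m , pm , min′
  where
  min′ : ∀ {k} → k < suc m → ¬ P k
  min′ {zero}  _         = ¬p0
  min′ {suc k} (s≤s k<m) = min k<m

module _ {R : S → S → Set p} (R-sym : ∀ {x y} → R x y → R y x) where

  lookup-injective : ∀ {xs} → AllPairs (λ x y → ¬ R x y) xs →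
                     ∀ i j → R (lookup xs i) (lookup xs j) → i ≡ j
  lookup-injective (x∉ ∷ u) Fin.zero    Fin.zero    r = refl
  lookup-injective {x ∷ xs} (x∉ ∷ u) Fin.zero    (Fin.suc j) r = contradiction r (All.lookup x∉ (∈-lookup j))
  lookup-injective {x ∷ xs} (x∉ ∷ u) (Fin.suc i) Fin.zero    r = contradiction (R-sym r) (All.lookup x∉ (∈-lookup i))
  lookup-injective (x∉ ∷ u) (Fin.suc i) (Fin.suc j) r = cong Fin.suc (lookup-injective u i j r)

  -- Exactly one entry of `xs` is related to `x`. This allows a sum over representatives to be
  -- inserted into each term, after which the order of summation is exchanged.
  ∑-representative : (R-trans : ∀ {x y z} → R x y → R y z → R x z) (R? : ∀ x y → Dec (R x y)) (v : ℚ) →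
    ∀ {xs x} → AllPairs (λ x y → ¬ R x y) xs → Any (λ y → R y x) xs →
    ∑′ xs (λ y → if does (R? y x) then v else 0ℚ) ≡ v
  ∑-representative R-trans R? v {y ∷ ys} {x} (y∉ ∷ u) (here r) = trans
    (cong₂ ℚ._+_ (if-yes (R? y x) r)
      (∑-0 ys (λ {z} z∈ → if-no (R? z x) (λ zx → All.lookup y∉ z∈ (R-trans r (R-sym zx))))))
    (ℚ.+-identityʳ v)
  ∑-representative R-trans R? v {y ∷ ys} {x} (y∉ ∷ u) (there x∈) = trans
    (cong₂ ℚ._+_ (if-no (R? y x) (λ yx → All.lookupWith (λ ¬yz zx → ¬yz (R-trans yx (R-sym zx))) y∉ x∈))
      (∑-representative R-trans R? v u x∈))
    (ℚ.+-identityˡ v)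

module FiniteAbelian {c ℓ} (G : Group c ℓ) (comm : ∀ x y → Group._≈_ G (Group._∙_ G x y) (Group._∙_ G y x))
                     {n} (card : HasCardinality (Group.setoid G) n) where
  open Group G hiding (_//_; _-_)
    renaming (refl to ≈-refl; sym to ≈-sym; trans to ≈-trans; reflexive to ≈-reflexive)
  open Algebra.Properties.Group G using (∙-cancelˡ; ∙-cancelʳ; inverseˡ-unique; inverseʳ-unique)
  open Algebra.Properties.Monoid.Mult monoid using (×-congʳ; ×-congˡ; ×-homo-+; ×-homo-1; ×-assocˡ)
    renaming (_×_ to infixr 8 _·_)
  private
    module B = Bijection card
    commutativeMonoid : CommutativeMonoid c ℓ
    commutativeMonoid = record { isCommutativeMonoid = record { isMonoid = isMonoid ; comm = comm } }
    open Algebra.Properties.CommutativeMonoid.Sum commutativeMonoid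
      using (sum; sum-permute; ∑-distrib-+; sum-replicate; sum-cong-≋)
    open Relation.Binary.Reasoning.Setoid setoid using (begin_; _∎; step-≈-⟩; step-≈-⟨)

  element : Fin n → Carrier
  element = B.to

  index : Carrier → Fin n
  index x = proj₁ (B.surjective x)

  element-index : ∀ x → element (index x) ≈ x
  element-index x = proj₂ (B.surjective x) refl

  index-cong : ∀ {x y} → x ≈ y → index x ≡ index y
  index-cong x≈y = B.injective (≈-trans (element-index _) (≈-trans x≈y (≈-sym (element-index _))))

  index-injective : ∀ {x y} → index x ≡ index y → x ≈ y
  index-injective {x} {y} eq = ≈-trans (≈-sym (element-index x))
    (≈-trans (≈-reflexive (cong element eq)) (element-index y))

  index-element : ∀ i → index (element i) ≡ i
  index-element i = B.injective (element-index _)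

  _≟_ : ∀ x y → Dec (x ≈ y)
  x ≟ y = map′ index-injective index-cong (index x Fin.≟ index y)

  private
    instance
      n≢0 : NonZero n
      n≢0 = Fin.nonZeroIndex (index ε)

  -- Translation by x permutes the elements, so their product s satisfies s ≈ n · x ∙ s.
  card·x≈ε : ∀ x → n · x ≈ ε
  card·x≈ε x = ∙-cancelʳ s _ _ (≈-sym (begin
    ε ∙ s                         ≈⟨ identityˡ s ⟩
    s                             ≈⟨ sum-permute element π ⟩
    sum (λ i → element (index (x ∙ element i))) ≈⟨ sum-cong-≋ (λ i → element-index (x ∙ element i)) ⟩
    sum (λ i → x ∙ element i)     ≈⟨ ∑-distrib-+ {n} (λ _ → x) element ⟩
    sum {n} (λ _ → x) ∙ s         ≈⟨ ∙-congʳ (sum-replicate n) ⟩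
    n · x ∙ s                     ∎))
    where
    s = sum element
    shift : Carrier → Fin n → Fin n
    shift y i = index (y ∙ element i)
    shift-inverse : ∀ {y z} → y ∙ z ≈ ε → ∀ i → shift y (shift z i) ≡ i
    shift-inverse {y} {z} yz≈ε i = trans (index-cong (begin
      y ∙ element (index (z ∙ element i)) ≈⟨ ∙-congˡ (element-index _) ⟩
      y ∙ (z ∙ element i)                 ≈⟨ assoc y z _ ⟨
      y ∙ z ∙ element i                   ≈⟨ ∙-congʳ yz≈ε ⟩
      ε ∙ element i                       ≈⟨ identityˡ _ ⟩
      element i                           ∎)) (index-element i)
    π : Perm.Permutation n n
    π = Perm.permutation (shift x) (shift (x ⁻¹)) (shift-inverse (inverseʳ x)) (shift-inverse (inverseˡ x))

  -- Orders of elements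

  leastOrder : ∀ x → ∃[ m ] (suc m · x ≈ ε × (∀ {k} → k < m → ¬ (suc k · x ≈ ε)))
  -- Searching over `suc k` skips the trivial exponent 0; the search ends at n, which annihilates x.
  leastOrder x = leastWitness (λ k → (suc k · x) ≟ ε) (pred n)
    (≈-trans (×-congˡ (ℕ.suc-pred n)) (card·x≈ε x))

  abstract
    order : Carrier → ℕ
    order x = suc (proj₁ (leastOrder x))

    order-nonZero : ∀ x → NonZero (order x)
    order-nonZero x = _

    order·x≈ε : ∀ x → order x · x ≈ ε
    order·x≈ε x = proj₁ (proj₂ (leastOrder x))

    order-minimal : ∀ {x k} → k < order x → k · x ≈ ε → k ≡ 0
    order-minimal {k = zero}      _         _    = refl
    order-minimal {x} {k = suc k} (s≤s k<m) kx≈ε = contradiction kx≈ε (proj₂ (proj₂ (leastOrder x)) k<m)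

  private instance
    order≢0 : ∀ {x} → NonZero (order x)
    order≢0 = order-nonZero _

  k·ε≈ε : ∀ k → k · ε ≈ ε
  k·ε≈ε zero    = ≈-refl
  k·ε≈ε (suc k) = ≈-trans (identityˡ _) (k·ε≈ε k)

  ∣⇒·≈ε : ∀ {x k m} → m · x ≈ ε → m ∣ k → k · x ≈ ε
  ∣⇒·≈ε {x} {k} {m} mx≈ε (divides q refl) = begin
    (q ℕ.* m) · x ≈⟨ ×-assocˡ x q m ⟨
    q · m · x     ≈⟨ ×-congʳ q mx≈ε ⟩
    q · ε         ≈⟨ k·ε≈ε q ⟩
    ε             ∎

  %-order : ∀ x k → (k % order x) · x ≈ k · x
  %-order x k = begin
    r · x                               ≈⟨ identityʳ _ ⟨
    r · x ∙ ε                           ≈⟨ ∙-congˡ (∣⇒·≈ε (order·x≈ε x) (n∣m*n (k / order x))) ⟨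
    r · x ∙ (k / order x ℕ.* order x) · x ≈⟨ ×-homo-+ x r _ ⟨
    (r ℕ.+ k / order x ℕ.* order x) · x ≈⟨ ×-congˡ (m≡m%n+[m/n]*n k (order x)) ⟨
    k · x                               ∎
    where r = k % order x

  ·≈ε⇒order∣ : ∀ {x k} → k · x ≈ ε → order x ∣ k
  ·≈ε⇒order∣ {x} {k} kx≈ε =
    m%n≡0⇒n∣m k (order x) (order-minimal (m%n<n k (order x)) (≈-trans (%-order x k) kx≈ε))

  order∣card : ∀ x → order x ∣ n
  order∣card x = ·≈ε⇒order∣ (card·x≈ε x)

  -- Generators of a cyclic subgroup

  infix 4 _⇝_ _∼_

  -- `y` lies in the cyclic subgroup generated by `x`. Natural exponents suffice, since the inverse
  -- of `x` is its multiple by n - 1.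
  _⇝_ : Carrier → Carrier → Set ℓ
  x ⇝ y = ∃[ k ] (y ≈ k · x)

  ⇝-reflexive : ∀ {x y} → x ≈ y → x ⇝ y
  ⇝-reflexive x≈y = 1 , ≈-trans (≈-sym x≈y) (≈-sym (×-homo-1 _))

  ⇝-trans : ∀ {x y z} → x ⇝ y → y ⇝ z → x ⇝ z
  ⇝-trans {x} (k , y≈kx) (l , z≈ly) = l ℕ.* k , ≈-trans z≈ly (≈-trans (×-congʳ l y≈kx) (×-assocˡ x l k))

  ⇝-⁻¹ : ∀ x → x ⇝ x ⁻¹
  ⇝-⁻¹ x = pred n , ≈-sym (inverseʳ-unique x (pred n · x) (≈-trans (×-congˡ (ℕ.suc-pred n)) (card·x≈ε x)))

  -- Exponents matter only modulo the order of `x`, so a finite search decides.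
  _⇝?_ : ∀ x y → Dec (x ⇝ y)
  x ⇝? y = map′ (λ (i , y≈) → toℕ i , y≈)
    (λ (k , y≈kx) → fromℕ< (m%n<n k (order x)) ,
      ≈-trans y≈kx (≈-trans (≈-sym (%-order x k)) (×-congˡ (sym (Fin.toℕ-fromℕ< (m%n<n k (order x)))))))
    (Fin.any? {n = order x} (λ i → y ≟ (toℕ i · x)))

  _∼_ : Carrier → Carrier → Set ℓ
  x ∼ y = x ⇝ y × y ⇝ x

  ∼-sym : ∀ {x y} → x ∼ y → y ∼ x
  ∼-sym (x⇝y , y⇝x) = y⇝x , x⇝y

  ∼-trans : ∀ {x y z} → x ∼ y → y ∼ z → x ∼ z
  ∼-trans (x⇝y , y⇝x) (y⇝z , z⇝y) = ⇝-trans x⇝y y⇝z , ⇝-trans z⇝y y⇝x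

  ∼-reflexive : ∀ {x y} → x ≈ y → x ∼ y
  ∼-reflexive x≈y = ⇝-reflexive x≈y , ⇝-reflexive (≈-sym x≈y)

  _∼?_ : ∀ x y → Dec (x ∼ y)
  x ∼? y = (x ⇝? y) ×-dec (y ⇝? x)

  ⇝⇒order∣ : ∀ {x y} → x ⇝ y → order y ∣ order x
  ⇝⇒order∣ {x} {y} (k , y≈kx) = ·≈ε⇒order∣ (begin
    order x · y           ≈⟨ ×-congʳ (order x) y≈kx ⟩
    order x · k · x       ≈⟨ ×-assocˡ x (order x) k ⟩
    (order x ℕ.* k) · x   ≈⟨ ∣⇒·≈ε (order·x≈ε x) (m∣m*n {order x} k) ⟩
    ε                     ∎)

  ∼⇒order≡ : ∀ {x y} → x ∼ y → order x ≡ order y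
  ∼⇒order≡ (x⇝y , y⇝x) = ∣-antisym (⇝⇒order∣ y⇝x) (⇝⇒order∣ x⇝y)

  ·-injective-≤ : ∀ {x k l} → k ≤ l → 1 ≤ k → l ≤ order x → k · x ≈ l · x → k ≡ l
  ·-injective-≤ {x} {k} {l} k≤l 1≤k l≤m kx≈lx =
    ℕ.≤-antisym k≤l (ℕ.m∸n≡0⇒m≤n (∣∧<⇒≡0 (·≈ε⇒order∣ l∸k·x≈ε) l∸k<m))
    where
    l∸k<m : l ∸ k < order x
    l∸k<m = ℕ.<-≤-trans (ℕ.∸-monoʳ-< {l} {k} {0} 1≤k k≤l) l≤m
    l∸k·x≈ε : (l ∸ k) · x ≈ ε
    l∸k·x≈ε = ∙-cancelˡ (k · x) _ _ (begin
      k · x ∙ (l ∸ k) · x ≈⟨ ×-homo-+ x k (l ∸ k) ⟨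
      (k ℕ.+ (l ∸ k)) · x ≈⟨ ×-congˡ (ℕ.m+[n∸m]≡n k≤l) ⟩
      l · x               ≈⟨ kx≈lx ⟨
      k · x               ≈⟨ identityʳ _ ⟨
      k · x ∙ ε           ∎)

  ·-injective : ∀ {x k l} → k ∈ range (order x) → l ∈ range (order x) → k · x ≈ l · x → k ≡ l
  ·-injective {x} {k} {l} k∈ l∈ eq with 1≤k , k≤m ← ∈-range⁻ k∈ | 1≤l , l≤m ← ∈-range⁻ l∈ | ℕ.≤-total k l
  ... | inj₁ k≤l = ·-injective-≤ k≤l 1≤k l≤m eq
  ... | inj₂ l≤k = sym (·-injective-≤ l≤k 1≤l k≤m (≈-sym eq))

  -- Exponents are normalised to 1, ..., order x, the range in which `φ` counts; the exponent 0 is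
  -- replaced by the order itself.
  range-exponent : ∀ {x y} → x ⇝ y → ∃[ k ] (k ∈ range (order x) × y ≈ k · x)
  range-exponent {x} {y} (k , y≈kx) = positive (k % order x) (m%n<n k (order x)) (≈-trans y≈kx (≈-sym (%-order x k)))
    where
    positive : ∀ r → r < order x → y ≈ r · x → ∃[ k ] (k ∈ range (order x) × y ≈ k · x)
    positive zero    _   y≈ = order x , ∈-range⁺ (ℕ.>-nonZero⁻¹ (order x)) ℕ.≤-refl , ≈-trans y≈ (≈-sym (order·x≈ε x))
    positive (suc r) r<m y≈ = suc r , ∈-range⁺ (s≤s z≤n) (ℕ.<⇒≤ r<m) , y≈

  -- Let d be a common divisor, k = k′ d and order x = m′ d. Then m′ · (k · x) = k′ · (order x · x)
  -- = ε, so the order of k · x, which is that of x, divides m′. Hence m′ d = m′ and d = 1.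
  ∼⇒coprime : ∀ {x k} → x ∼ k · x → Coprime k (order x)
  ∼⇒coprime {x} {k} x∼kx {d} (divides k′ refl , d∣m@(divides m′ m≡m′d)) = ℕ.*-cancelˡ-≡ d 1 m′ {{m′≢0}}
    (trans (sym m≡m′d) (trans (∣-antisym m∣m′ (divides d (trans m≡m′d (ℕ.*-comm m′ d)))) (sym (ℕ.*-identityʳ m′))))
    where
    m′≢0 : NonZero m′
    m′≢0 = ℕ.m*n≢0⇒m≢0 m′ {{subst NonZero m≡m′d order≢0}}
    m∣m′ : order x ∣ m′
    m∣m′ = subst (_∣ m′) (sym (∼⇒order≡ x∼kx)) (·≈ε⇒order∣ (≈-trans (×-assocˡ x m′ (k′ ℕ.* d))
      (∣⇒·≈ε (order·x≈ε x) (divides k′ m′k≡k′m))))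
      where
      m′k≡k′m : m′ ℕ.* (k′ ℕ.* d) ≡ k′ ℕ.* order x
      m′k≡k′m = trans (sym (ℕ.*-assoc m′ k′ d)) (trans (cong (ℕ._* d) (ℕ.*-comm m′ k′))
        (trans (ℕ.*-assoc k′ m′ d) (cong (k′ ℕ.*_) (sym m≡m′d))))

  coprime⇒∼ : ∀ {x k} → Coprime k (order x) → x ∼ k · x
  coprime⇒∼ {x} {k} c = (k , ≈-refl) , generated (coprime-Bézout c)
    where
    generated : Bézout.Identity 1 k (order x) → k · x ⇝ x
    generated (Bézout.+- a b eq) = a , ≈-sym (begin
      a · k · x                      ≈⟨ ×-assocˡ x a k ⟩
      (a ℕ.* k) · x                  ≈⟨ ×-congˡ eq ⟨
      x ∙ (b ℕ.* order x) · x        ≈⟨ ∙-congˡ (∣⇒·≈ε (order·x≈ε x) (n∣m*n b)) ⟩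
      x ∙ ε                          ≈⟨ identityʳ x ⟩
      x                              ∎)
    -- In this case a k ≡ -1 modulo the order, so a · k · x is the inverse of x and has to be
    -- inverted once more.
    generated (Bézout.-+ a b eq) = ⇝-trans (a , ≈-refl) (⇝-trans (⇝-⁻¹ (a · k · x)) (⇝-reflexive (≈-sym
      (inverseˡ-unique x (a · k · x) (begin
        x ∙ a · k · x         ≈⟨ ∙-congˡ (×-assocˡ x a k) ⟩
        x ∙ (a ℕ.* k) · x     ≈⟨ ×-congˡ eq ⟩
        (b ℕ.* order x) · x   ≈⟨ ∣⇒·≈ε (order·x≈ε x) (n∣m*n b) ⟩
        ε                     ∎)))))

  -- The generators are the k · x with 1 ≤ k ≤ order x and k coprime to the order; `·-injective`
  -- shows that none is listed twice.
  generators-count : ∀ x → length (filter (λ i → x ∼? element i) (allFin n)) ≡ φ (order x)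
  generators-count x = trans (↭.↭-length (unique-↭ (Unique.filter⁺ _ (Unique.allFin⁺ n))
    (unique-map (λ k∈ l∈ eq → ·-injective (in-range k∈) (in-range l∈) (index-injective eq))
      (Unique.filter⁺ C? (unique-range m))) to from)) (length-map _ (filter C? (range m)))
    where
    m = order x
    C? : Decidable (λ k → Coprime k m)
    C? k = coprime? k m
    in-range : ∀ {k} → k ∈ filter C? (range m) → k ∈ range m
    in-range k∈ = proj₁ (∈-filter⁻ C? {xs = range m} k∈)
    to : ∀ {i} → i ∈ filter (λ i → x ∼? element i) (allFin n) →
         i ∈ map (λ k → index (k · x)) (filter C? (range m))
    to {i} i∈ with _ , x∼y ← ∈-filter⁻ (λ i → x ∼? element i) {xs = allFin n} i∈
      with k , k∈ , y≈kx ← range-exponent (proj₁ x∼y) =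
      subst (_∈ map (λ k → index (k · x)) (filter C? (range m)))
        (trans (index-cong (≈-sym y≈kx)) (index-element i))
        (∈-map⁺ (λ k → index (k · x)) (∈-filter⁺ C? k∈ (∼⇒coprime (∼-trans x∼y (∼-reflexive y≈kx)))))
    from : ∀ {i} → i ∈ map (λ k → index (k · x)) (filter C? (range m)) →
           i ∈ filter (λ i → x ∼? element i) (allFin n)
    from i∈ with k , k∈ , refl ← ∈-map⁻ (λ k → index (k · x)) i∈ =
      ∈-filter⁺ (λ i → x ∼? element i) (∈-allFin _)
        (∼-trans (coprime⇒∼ (proj₂ (∈-filter⁻ C? {xs = range m} k∈))) (∼-reflexive (≈-sym (element-index (k · x)))))

  -- Counting cyclic subgroups by classes of generators

  private
    ∼-decSetoid : DecSetoid 0ℓ ℓ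
    ∼-decSetoid = record
      { Carrier = Fin n
      ; _≈_ = λ i j → element i ∼ element j
      ; isDecEquivalence = record
        { isEquivalence = record { refl = ∼-reflexive ≈-refl ; sym = ∼-sym ; trans = ∼-trans }
        ; _≟_ = λ i j → element i ∼? element j
        }
      }

    representatives : List (Fin n)
    representatives = deduplicate (λ i j → element i ∼? element j) (allFin n)

    representatives-unique : AllPairs (λ i j → ¬ (element i ∼ element j)) representatives
    representatives-unique = Uniqueₛ.deduplicate-! ∼-decSetoid (allFin n)

    representatives-complete : ∀ i → Any (λ r → element i ∼ element r) representatives
    representatives-complete i = Membershipₛ.∈-deduplicate⁺
      (DecSetoid.setoid ∼-decSetoid) (DecSetoid._≟_ ∼-decSetoid)
      (λ y∼z x∼y → ∼-trans x∼y (∼-sym y∼z)) (Any.map (λ { refl → ∼-reflexive ≈-refl }) (∈-allFin i))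

  cyclicSubgroupCount : ℕ
  cyclicSubgroupCount = length representatives

  cyclicSubgroupCount-∑ : cyclicSubgroupCount // 1 ≡ ∑′ (allFin n) (λ i → 1 // φ (order (element i)))
  cyclicSubgroupCount-∑ = sym (begin-≡
    ∑′ (allFin n) w
      ≡⟨ ∑-cong (allFin n) (λ {i} _ → sym (∑-representative ∼-sym ∼-trans (λ r i → element r ∼? element i) (w i)
           representatives-unique (Any.map ∼-sym (representatives-complete i)))) ⟩
    ∑′ (allFin n) (λ i → ∑′ representatives (λ r → if does (element r ∼? element i) then w i else 0ℚ))
      ≡⟨ ∑-swap (allFin n) representatives _ ⟩
    ∑′ representatives (λ r → ∑′ (allFin n) (λ i → if does (element r ∼? element i) then w i else 0ℚ))
      ≡⟨ ∑-cong representatives (λ {r} _ → class-sum r) ⟩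
    ∑′ representatives (λ _ → 1ℚ)
      ≡⟨ ∑-1 representatives ⟩
    cyclicSubgroupCount // 1 ∎≡)
    where
    open ≡-Reasoning using (step-≡-⟩; step-≡-⟨) renaming (begin_ to begin-≡_; _∎ to _∎≡)
    w : Fin n → ℚ
    w i = 1 // φ (order (element i))
    -- The order is constant, say m, on a class of generators, and the class has φ(m) members of
    -- weight 1/φ(m).
    class-sum : ∀ r → ∑′ (allFin n) (λ i → if does (element r ∼? element i) then w i else 0ℚ) ≡ 1ℚ
    class-sum r = begin-≡
      ∑′ (allFin n) (λ i → if does (element r ∼? element i) then w i else 0ℚ)
        ≡⟨ ∑-filter (λ i → element r ∼? element i) (allFin n) w ⟨
      ∑′ C w
        ≡⟨ ∑-cong C (λ i∈ → cong (λ m → 1 // φ m)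
             (sym (∼⇒order≡ (proj₂ (∈-filter⁻ (λ i → element r ∼? element i) {xs = allFin n} i∈))))) ⟩
      ∑′ C (λ _ → 1 // φm)
        ≡⟨ ∑-const (1 // φm) C ⟩
      (length C // 1) ℚ.* (1 // φm)
        ≡⟨ cong (λ t → (t // 1) ℚ.* (1 // φm)) (generators-count (element r)) ⟩
      (φm // 1) ℚ.* (1 // φm)
        ≡⟨ m//n*n//m≡1 φm 1 {{φ-nonZero m}} ⟩
      1ℚ ∎≡
      where
      C = filter (λ i → element r ∼? element i) (allFin n)
      m = order (element r)
      φm = φ m

  ⟨_⟩ : Carrier → CyclicSubgroup G ℓ
  ⟨ x ⟩ = record
    { members    = x ⇝_
    ; isSubgroup = record
      { respects  = λ y≈z x⇝y → ⇝-trans x⇝y (⇝-reflexive y≈z)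
      ; ε-closed  = 0 , ≈-refl
      ; ∙-closed  = λ (k , y≈kx) (l , z≈lx) → k ℕ.+ l , ≈-trans (∙-cong y≈kx z≈lx) (≈-sym (×-homo-+ x k l))
      ; ⁻¹-closed = λ {y} x⇝y → ⇝-trans x⇝y (⇝-⁻¹ y)
      }
    ; isCyclic   = x , ⇝-reflexive ≈-refl , λ (k , y≈kx) → ℤ.+ k , y≈kx
    }

  ^ᶻ⇒⇝ : ∀ x k → x ⇝ _^ᶻ_ G x k
  ^ᶻ⇒⇝ x (ℤ.+ k)    = k , ≈-refl
  ^ᶻ⇒⇝ x (ℤ.-[1+ k ]) = ⇝-trans (suc k , ≈-refl) (⇝-⁻¹ (suc k · x))

  -- Subgroups with the same members contain each other's generators, so their representatives are
  -- equivalent and hence equal. Conversely, the generator recorded in a subgroup is equivalent to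
  -- some representative.
  cyclicSubgroups-cardinality : HasCardinality (cyclicSubgroups G ℓ) cyclicSubgroupCount
  cyclicSubgroups-cardinality = record
    { to        = subgroup
    ; cong      = λ { refl → (λ h → h) , (λ h → h) }
    ; bijective = injective , surjective
    }
    where
    subgroup : Fin cyclicSubgroupCount → CyclicSubgroup G ℓ
    subgroup i = ⟨ element (lookup representatives i) ⟩
    open Setoid (cyclicSubgroups G ℓ) using () renaming (_≈_ to _≐_)
    injective : ∀ {i j} → subgroup i ≐ subgroup j → i ≡ j
    injective {i} {j} (i⊆j , j⊆i) =
      lookup-injective {R = λ i j → element i ∼ element j} ∼-sym representatives-unique i j
        (j⊆i (⇝-reflexive ≈-refl) , i⊆j (⇝-reflexive ≈-refl))
    surjective : ∀ H → ∃[ i ] (∀ {j} → j ≡ i → subgroup j ≐ H)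
    surjective H with g , g∈H , generates ← CyclicSubgroup.isCyclic H =
      Any.index found , λ { refl →
        (λ r⇝y → closed (⇝-trans (proj₁ g∼r) r⇝y)) ,
        (λ y∈H → ⇝-trans (proj₂ g∼r) (let k , y≈ = generates y∈H in ⇝-trans (^ᶻ⇒⇝ g k) (⇝-reflexive (≈-sym y≈)))) }
      where
      open CyclicSubgroup H using (members; isSubgroup)
      open IsSubgroup isSubgroup
      found = representatives-complete (index g)
      g∼r : g ∼ element (lookup representatives (Any.index found))
      g∼r = ∼-trans (∼-reflexive (≈-sym (element-index g))) (Any.lookup-index found)
      powers : ∀ k → members (k · g)
      powers zero    = ε-closed
      powers (suc k) = ∙-closed g∈H (powers k)
      closed : ∀ {y} → g ⇝ y → members y
      closed (k , y≈kg) = respects (≈-sym y≈kg) (powers k)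

-- The unit group of ℤ/q

-- The multiples d = e m of `m` among the divisors of `n` correspond to the divisors e of n/m. With
-- the condition m ∣ d as a guard, the index set no longer depends on `m`, so this sum can be
-- exchanged with the sum over group elements.
1//φ-∑ : ∀ {n m} .{{_ : NonZero n}} → m ∣ n →
  1 // φ m ≡ ∑[ d ∈ divisors n ] (if does (m ∣? d) then coefficient d (n quo d) else 0ℚ)
1//φ-∑ {n} {m} m∣n@(divides k n≡km) = begin
  1 // φ m
    ≡⟨ coefficient-sum k m ⟨
  ∑ (divisors k) (λ e → coefficient (e *ℕ m) (k quo e))
    ≡⟨ ∑-cong (divisors k) reindex ⟩
  ∑ (divisors k) (λ e → coefficient (e *ℕ m) (n quo (e *ℕ m)))
    ≡⟨ ∑-map (_*ℕ m) (divisors k) c ⟨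
  ∑ (map (_*ℕ m) (divisors k)) c
    ≡⟨ ∑-↭ c (unique-↭ (Unique.map⁺ (ℕ.*-cancelʳ-≡ _ _ m) (unique-divisors k))
         (Unique.filter⁺ (m ∣?_) (unique-divisors n)) to from) ⟩
  ∑ (filter (m ∣?_) (divisors n)) c
    ≡⟨ ∑-filter (m ∣?_) (divisors n) c ⟩
  ∑ (divisors n) (λ d → if does (m ∣? d) then c d else 0ℚ) ∎
  where
  open ≡-Reasoning
  c : ℕ → ℚ
  c d = coefficient d (n quo d)
  instance
    km≢0 : NonZero (k *ℕ m)
    km≢0 = subst NonZero n≡km (ℕ.≢-nonZero (ℕ.≢-nonZero⁻¹ n))
    k≢0 : NonZero k
    k≢0 = ℕ.m*n≢0⇒m≢0 k
    m≢0 : NonZero m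
    m≢0 = ℕ.m*n≢0⇒n≢0 k
  reindex : ∀ {e} → e ∈ divisors k → coefficient (e *ℕ m) (k quo e) ≡ c (e *ℕ m)
  reindex {e} e∈ with r , k≡re , quo≡ ← ∣-*-quo {k = k} e∈ = cong (coefficient (e *ℕ m)) (trans quo≡
    (sym (quo-≡ (e *ℕ m) (ℕ.*-mono-≤ (proj₁ (∈-divisors⁻ {n = k} e∈)) (ℕ.>-nonZero⁻¹ m))
      (trans n≡km (trans (cong (_*ℕ m) k≡re) (ℕ.*-assoc r e m))))))
  to : ∀ {d} → d ∈ map (_*ℕ m) (divisors k) → d ∈ filter (m ∣?_) (divisors n)
  to d∈ with e , e∈ , refl ← ∈-map⁻ (_*ℕ m) d∈ = ∈-filter⁺ (m ∣?_)
    (∈-divisors⁺ (subst (e *ℕ m ∣_) (sym n≡km) (*-monoˡ-∣ m (proj₂ (∈-divisors⁻ {n = k} e∈))))) (n∣m*n e)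
  from : ∀ {d} → d ∈ filter (m ∣?_) (divisors n) → d ∈ map (_*ℕ m) (divisors k)
  from d∈ with d∈′ , divides e refl ← ∈-filter⁻ (m ∣?_) {xs = divisors n} d∈ =
    ∈-map⁺ (_*ℕ m) {x = e} (∈-divisors⁺ {e} {k} (*-cancelʳ-∣ {e} m
      (subst (e *ℕ m ∣_) n≡km (proj₂ (∈-divisors⁻ {n = n} d∈′)))))

module ResidueUnits (q : ℕ) (3≤q : 3 ≤ q) where
  open import Data.Integer.Base using (+_; -[1+_])
  private
    module R = CommutativeRing (ℤ/ q)
    module U = Group [ℤ/ q ]ˣ
    open Unit
    instance
      q≢0 : NonZero q
      q≢0 = ℕ.>-nonZero (ℕ.≤-trans (s≤s z≤n) 3≤q)

  ≡-mod⇒≡-≤ : ∀ {x y} → y ≤ x → 1 ≤ y → x ≤ q → + x ≡ + y [mod q ] → x ≡ y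
  ≡-mod⇒≡-≤ {x} {y} y≤x 1≤y x≤q q∣ = ℕ.≤-antisym (ℕ.m∸n≡0⇒m≤n (∣∧<⇒≡0 q∣x∸y x∸y<q)) y≤x
    where
    q∣x∸y : q ∣ x ∸ y
    q∣x∸y = ℤ.∣⇒∣ᵤ (subst (+ q ℤ.∣_) (trans (ℤ.m-n≡m⊖n x y) (ℤ.⊖-≥ y≤x)) q∣)
    x∸y<q : x ∸ y < q
    x∸y<q = ℕ.<-≤-trans (ℕ.∸-monoʳ-< {x} {y} {0} 1≤y y≤x) x≤q

  ≡-mod⇒≡ : ∀ {x y} → x ∈ range q → y ∈ range q → + x ≡ + y [mod q ] → x ≡ y
  ≡-mod⇒≡ {x} {y} x∈ y∈ eq with 1≤x , x≤q ← ∈-range⁻ x∈ | 1≤y , y≤q ← ∈-range⁻ y∈ | ℕ.≤-total y x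
  ... | inj₁ y≤x = ≡-mod⇒≡-≤ y≤x 1≤y x≤q eq
  ... | inj₂ x≤y = sym (≡-mod⇒≡-≤ x≤y 1≤x y≤q (R.sym {+ x} {+ y} eq))

  -- A common divisor of x and q divides both a x and a x - 1.
  invertible⇒coprime : ∀ {x} a → a ℤ.* + x ≡ + 1 [mod q ] → Coprime x q
  invertible⇒coprime {x} a q∣ax-1 {d} (d∣x , d∣q) = ∣1⇒≡1 (ℤ.∣⇒∣ᵤ d∣1)
    where
    d∣1 : + d ℤ.∣ + 1
    d∣1 = subst (+ d ℤ.∣_) (identity (a ℤ.* + x)) (ℤ.∣m∣n⇒∣m+n
      (ℤ.∣n⇒∣m*n a (ℤ.∣ᵤ⇒∣ {+ d} {+ x} d∣x))
      (ℤ.∣m⇒∣-m (ℤ.∣-trans (ℤ.∣ᵤ⇒∣ {+ d} {+ q} d∣q) q∣ax-1)))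
      where
      identity : ∀ z → z ℤ.+ ℤ.- (z ℤ.- + 1) ≡ + 1
      identity = ℤ.solve-∀

  abstract
    bézoutInverse : ∀ {x} → Bézout.Identity 1 x q → ∃[ a ] (a ℤ.* + x ≡ + 1 [mod q ])
    bézoutInverse {x} (Bézout.+- a b eq) = + a , ℤ.divides (+ b) (begin
      + a ℤ.* + x ℤ.- + 1        ≡⟨ cong (ℤ._- + 1) (ℤ.pos-* a x) ⟨
      + (a *ℕ x) ℤ.- + 1         ≡⟨ cong (λ t → + t ℤ.- + 1) eq ⟨
      + (1 ℕ.+ b *ℕ q) ℤ.- + 1   ≡⟨ cancel (+ (b *ℕ q)) ⟩
      + (b *ℕ q)                 ≡⟨ ℤ.pos-* b q ⟩
      + b ℤ.* + q                ∎)
      where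
      open ≡-Reasoning
      cancel : ∀ z → + 1 ℤ.+ z ℤ.- + 1 ≡ z
      cancel = ℤ.solve-∀
    bézoutInverse {x} (Bézout.-+ a b eq) = ℤ.- + a , ℤ.divides (ℤ.- + b) (begin
      ℤ.- + a ℤ.* + x ℤ.- + 1      ≡⟨ negate (+ a) (+ x) ⟩
      ℤ.- (+ 1 ℤ.+ + a ℤ.* + x)    ≡⟨ cong (λ t → ℤ.- (+ 1 ℤ.+ t)) (ℤ.pos-* a x) ⟨
      ℤ.- (+ (1 ℕ.+ a *ℕ x))       ≡⟨ cong (λ t → ℤ.- (+ t)) eq ⟩
      ℤ.- (+ (b *ℕ q))             ≡⟨ cong ℤ.-_ (ℤ.pos-* b q) ⟩
      ℤ.- (+ b ℤ.* + q)            ≡⟨ ℤ.neg-distribˡ-* (+ b) (+ q) ⟩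
      ℤ.- + b ℤ.* + q              ∎)
      where
      open ≡-Reasoning
      negate : ∀ a x → ℤ.- a ℤ.* x ℤ.- + 1 ≡ ℤ.- (+ 1 ℤ.+ a ℤ.* x)
      negate = ℤ.solve-∀

  coprimeUnit : ∀ {x} → Coprime x q → U.Carrier
  coprimeUnit {x} c with a , ax≡1 ← bézoutInverse (coprime-Bézout c) = record
    { value    = + x
    ; inverse  = a
    ; inverseˡ = ax≡1
    ; inverseʳ = subst (_≡ + 1 [mod q ]) (ℤ.*-comm a (+ x)) ax≡1
    }

  residues : List ℕ
  residues = filter (λ k → coprime? k q) (range q)

  unique-residues : Unique residues
  unique-residues = Unique.filter⁺ (λ k → coprime? k q) (unique-range q)

  -- `φ` counts in 1, ..., q and `ρ` in 0, ..., q - 1. The ranges differ only in the representative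
  -- of the class 0, and neither q nor 0 is coprime to q.
  coprime⇒≢q : ∀ {x} → Coprime x q → x ≢ q
  coprime⇒≢q c refl = ℕ.<⇒≢ (ℕ.≤-trans (s≤s (s≤s z≤n)) 3≤q) (sym (c (∣-refl , ∣-refl)))

  coprime⇒≥1 : ∀ {x} → Coprime x q → 1 ≤ x
  coprime⇒≥1 {zero}  c = contradiction (sym (c {q} (q ∣0 , ∣-refl))) (ℕ.<⇒≢ (ℕ.≤-trans (s≤s (s≤s z≤n)) 3≤q))
  coprime⇒≥1 {suc x} c = s≤s z≤n

  private
    residue : Fin (φ q) → ℕ
    residue = lookup residues

    residue-coprime : ∀ i → Coprime (residue i) q
    residue-coprime i = proj₂ (∈-filter⁻ (λ k → coprime? k q) {xs = range q} (∈-lookup {xs = residues} i))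

    residue-range : ∀ i → residue i ∈ range q
    residue-range i = proj₁ (∈-filter⁻ (λ k → coprime? k q) {xs = range q} (∈-lookup {xs = residues} i))

    residue-injective : ∀ {i j} → residue i ≡ residue j → i ≡ j
    residue-injective {i} {j} = lookup-injective {R = _≡_} sym unique-residues i j

    residue-surjective : ∀ {x} → Coprime x q → x ≤ q → ∃[ i ] (residue i ≡ x)
    residue-surjective {x} c x≤q = Any.index x∈ , sym (Any.lookup-index x∈)
      where
      x∈ : x ∈ residues
      x∈ = ∈-filter⁺ (λ k → coprime? k q) (∈-range⁺ (coprime⇒≥1 c) x≤q) c

  %ℕ-≡ : ∀ v → + (v ℤ.%ℕ q) ≡ v [mod q ]
  %ℕ-≡ v = R.sym {v} {+ (v ℤ.%ℕ q)} (ℤ.divides (v ℤ./ℕ q) (begin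
    v ℤ.- + (v ℤ.%ℕ q)
      ≡⟨ cong (ℤ._- + (v ℤ.%ℕ q)) (ℤ.a≡a%ℕn+[a/ℕn]*n v q) ⟩
    + (v ℤ.%ℕ q) ℤ.+ v ℤ./ℕ q ℤ.* + q ℤ.- + (v ℤ.%ℕ q)
      ≡⟨ cancel (+ (v ℤ.%ℕ q)) (v ℤ./ℕ q ℤ.* + q) ⟩
    v ℤ./ℕ q ℤ.* + q ∎))
    where
    open ≡-Reasoning
    cancel : ∀ r s → r ℤ.+ s ℤ.- r ≡ s
    cancel = ℤ.solve-∀

  unit : Fin (φ q) → U.Carrier
  unit i = coprimeUnit (residue-coprime i)

  private abstract
    unit-injective : ∀ {i j} → unit i U.≈ unit j → i ≡ j
    unit-injective {i} {j} eq = residue-injective (≡-mod⇒≡ (residue-range i) (residue-range j) eq)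

    unit-surjective : ∀ u → ∃[ i ] (∀ {j} → j ≡ i → unit j U.≈ u)
    unit-surjective u = preimage (residue-surjective
      -- The remainder r is congruent to the value of u, so the inverse of u also inverts r.
      (invertible⇒coprime (inverse u) (R.trans {inverse u ℤ.* + r} {inverse u ℤ.* value u} {+ 1}
        (R.*-congˡ {inverse u} {+ r} {value u} (%ℕ-≡ (value u))) (inverseˡ u)))
      (ℕ.<⇒≤ (ℤ.n%ℕd<d (value u) q)))
      where
      r : ℕ
      r = value u ℤ.%ℕ q
      preimage : ∃[ i ] (residue i ≡ r) → ∃[ i ] (∀ {j} → j ≡ i → unit j U.≈ u)
      preimage (i , eq) = i , λ { refl → subst (λ t → + t ≡ value u [mod q ]) (sym eq) (%ℕ-≡ (value u)) }

  units-cardinality : HasCardinality U.setoid (φ q)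
  units-cardinality = record
    { to        = unit
    ; cong      = λ { {i} refl → U.refl {unit i} }
    ; bijective = (λ {i} {j} → unit-injective {i} {j}) , unit-surjective
    }

  module F = FiniteAbelian [ℤ/ q ]ˣ (λ u v → R.*-comm (value u) (value v)) units-cardinality
  open Algebra.Properties.Monoid.Mult U.monoid using () renaming (_×_ to infixr 8 _·_)

  value-· : ∀ d u → value (d · u) ≡ value u ℤ.^ d
  value-· zero    u = refl
  value-· (suc d) u = cong (value u ℤ.*_) (value-· d u)

  2∣φ : 2 ∣ φ q
  2∣φ = subst (_∣ φ q) order≡2 (F.order∣card -1ᵤ)
    where
    -1ᵤ : U.Carrier
    -1ᵤ = record { value = -[1+ 0 ] ; inverse = -[1+ 0 ] ; inverseˡ = R.refl {+ 1} ; inverseʳ = R.refl {+ 1} }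
    order≢1 : F.order -1ᵤ ≢ 1
    -- Order 1 would mean -1 ≡ 1, that is q ∣ 2.
    order≢1 eq = ℕ.<⇒≱ 3≤q (∣⇒≤ (ℤ.∣⇒∣ᵤ {+ q} { -[1+ 1 ]}
      (subst (λ m → value (m · -1ᵤ) ≡ + 1 [mod q ]) eq (F.order·x≈ε -1ᵤ))))
    order≡2 : F.order -1ᵤ ≡ 2
    order≡2 = [ (λ o≡1 → contradiction o≡1 order≢1) , (λ o≡2 → o≡2) ]′
      (prime⇒irreducible prime[2] (F.·≈ε⇒order∣ { -1ᵤ} {2} (R.refl {+ 1})))

  -- Roots of unity, orders and the final count

  order? : ∀ d → Decidable (λ i → F.order (unit i) ∣ d)
  order? d i = F.order (unit i) ∣? d

  -- Since d ≥ 1, a root x of x^d ≡ 1 has the inverse x^(d - 1), so it is one of the residues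
  -- coprime to q. For these the equation says that the order divides d.
  ρ-count : ∀ d → 1 ≤ d → ρ q d ≡ length (filter (order? d) (allFin (φ q)))
  ρ-count d@(suc d-1) _ = trans
    (↭.↭-length (unique-↭ (Unique.filter⁺ root? (Unique.upTo⁺ q))
      (Unique.map⁺ residue-injective (Unique.filter⁺ (order? d) (Unique.allFin⁺ (φ q)))) to from))
    (length-map residue (filter (order? d) (allFin (φ q))))
    where
    root? : Decidable (λ x → (+ x) ℤ.^ d ≡ + 1 [mod q ])
    root? x = ((+ x) ℤ.^ d) ≡? + 1 [mod q ]
    I : List (Fin (φ q))
    I = filter (order? d) (allFin (φ q))
    root⇒order : ∀ {i} → (+ residue i) ℤ.^ d ≡ + 1 [mod q ] → F.order (unit i) ∣ d
    root⇒order {i} eq = F.·≈ε⇒order∣ {unit i} {d} (subst (_≡ + 1 [mod q ]) (sym (value-· d (unit i))) eq)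
    order⇒root : ∀ {i} → F.order (unit i) ∣ d → (+ residue i) ℤ.^ d ≡ + 1 [mod q ]
    order⇒root {i} o∣d = subst (_≡ + 1 [mod q ]) (value-· d (unit i))
      (F.∣⇒·≈ε {unit i} {d} {F.order (unit i)} (F.order·x≈ε (unit i)) o∣d)
    to : ∀ {x} → x ∈ filter root? (upTo q) → x ∈ map residue I
    to {x} x∈ = image (residue-surjective
        (invertible⇒coprime ((+ x) ℤ.^ d-1) (subst (_≡ + 1 [mod q ]) (ℤ.*-comm (+ x) ((+ x) ℤ.^ d-1)) x^d≡1))
        (ℕ.<⇒≤ (∈-upTo⁻ (proj₁ (∈-filter⁻ root? {xs = upTo q} x∈)))))
      where
      x^d≡1 = proj₂ (∈-filter⁻ root? {xs = upTo q} x∈)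
      image : ∃[ i ] (residue i ≡ x) → x ∈ map residue I
      image (i , eq) = subst (_∈ map residue I) eq (∈-map⁺ residue (∈-filter⁺ (order? d) (∈-allFin i)
        (root⇒order (subst (λ t → (+ t) ℤ.^ d ≡ + 1 [mod q ]) (sym eq) x^d≡1))))
    from : ∀ {x} → x ∈ map residue I → x ∈ filter root? (upTo q)
    from {x} x∈ = preimage (∈-map⁻ residue x∈)
      where
      preimage : ∃[ i ] (i ∈ I × x ≡ residue i) → x ∈ filter root? (upTo q)
      preimage (i , i∈ , eq) = subst (_∈ filter root? (upTo q)) (sym eq) (∈-filter⁺ root?
        (∈-upTo⁺ (ℕ.≤∧≢⇒< (proj₂ (∈-range⁻ (residue-range i))) (coprime⇒≢q (residue-coprime i))))
        (order⇒root (proj₂ (∈-filter⁻ (order? d) {xs = allFin (φ q)} i∈))))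

  private instance
    φ≢0 : NonZero (φ q)
    φ≢0 = φ-nonZero q

  cyclicSubgroupCount-ρ : F.cyclicSubgroupCount // 1 ≡
    ∑[ d ∈ evenDivisors (φ q) ] ((ρ q d // 1) * coefficient d (φ q quo d))
  cyclicSubgroupCount-ρ = begin
    F.cyclicSubgroupCount // 1
      ≡⟨ F.cyclicSubgroupCount-∑ ⟩
    ∑′ Is (λ i → 1 // φ (F.order (unit i)))
      ≡⟨ ∑-cong Is (λ {i} _ → 1//φ-∑ (F.order∣card (unit i))) ⟩
    ∑′ Is (λ i → ∑′ D (λ d → if does (order? d i) then c d else 0ℚ))
      ≡⟨ ∑-swap Is D (λ i d → if does (order? d i) then c d else 0ℚ) ⟩
    ∑′ D (λ d → ∑′ Is (λ i → if does (order? d i) then c d else 0ℚ))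
      ≡⟨ ∑-cong D (λ {d} d∈ → count d (proj₁ (∈-divisors⁻ {n = φ q} d∈))) ⟩
    ∑′ D (λ d → (ρ q d // 1) * c d)
      ≡⟨ ∑-split (2 ∣?_) D (λ d → (ρ q d // 1) * c d) ⟩
    ∑ (evenDivisors (φ q)) (λ d → (ρ q d // 1) * c d) ℚ.+ ∑ (filter (¬? ∘ (2 ∣?_)) D) (λ d → (ρ q d // 1) * c d)
      ≡⟨ cong (∑ (evenDivisors (φ q)) (λ d → (ρ q d // 1) * c d) ℚ.+_)
           (∑-0 (filter (¬? ∘ (2 ∣?_)) D) odd) ⟩
    ∑ (evenDivisors (φ q)) (λ d → (ρ q d // 1) * c d) ℚ.+ 0ℚ
      ≡⟨ ℚ.+-identityʳ _ ⟩
    ∑ (evenDivisors (φ q)) (λ d → (ρ q d // 1) * c d) ∎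
    where
    open ≡-Reasoning
    Is = allFin (φ q)
    D = divisors (φ q)
    c : ℕ → ℚ
    c d = coefficient d (φ q quo d)
    count : ∀ d → 1 ≤ d → ∑′ Is (λ i → if does (order? d i) then c d else 0ℚ) ≡ (ρ q d // 1) * c d
    count d 1≤d = begin
      ∑′ Is (λ i → if does (order? d i) then c d else 0ℚ) ≡⟨ ∑-filter (order? d) Is (λ _ → c d) ⟨
      ∑′ X (λ _ → c d)                                       ≡⟨ ∑-const (c d) X ⟩
      (length X // 1) * c d                                  ≡⟨ cong (λ t → (t // 1) * c d) (ρ-count d 1≤d) ⟨
      (ρ q d // 1) * c d                                     ∎
      where X = filter (order? d) Is
    odd : ∀ {d} → d ∈ filter (¬? ∘ (2 ∣?_)) D → (ρ q d // 1) * c d ≡ 0ℚ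
    odd {d} d∈ = trans (cong ((ρ q d // 1) *_) (coefficient-odd {d} {φ q quo d} {{quo≢0}} 2∤d 2∣quo))
                       (ℚ.*-zeroʳ (ρ q d // 1))
      where
      2∤d : 2 ∤ d
      2∤d = proj₂ (∈-filter⁻ (¬? ∘ (2 ∣?_)) {xs = D} d∈)
      φ≡quo*d : φ q ≡ (φ q quo d) *ℕ d
      φ≡quo*d = quo-* (proj₁ (∈-filter⁻ (¬? ∘ (2 ∣?_)) {xs = D} d∈))
      quo≢0 : NonZero (φ q quo d)
      quo≢0 = ℕ.m*n≢0⇒m≢0 (φ q quo d) {{subst NonZero φ≡quo*d φ≢0}}
      -- φ(q) is even and d is odd, so the cofactor is even and 2 occurs in its product of local
      -- factors.
      2∣quo : 2 ∣ φ q quo d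
      2∣quo = [ (λ h → h) , (λ 2∣d → contradiction 2∣d 2∤d) ]′
        (euclidsLemma (φ q quo d) d prime[2] (subst (2 ∣_) φ≡quo*d 2∣φ))

proposition7p3 : (q : ℕ) → 3 ≤ q →
  Σ[ N ∈ ℕ ] (HasCardinality (cyclicSubgroups [ℤ/ q ]ˣ 0ℓ) N ×
    (N // 1 ≡
      (∏[ p ∈ oddPrimeDivisors (φ q) ] ((p ∸ 2) // (p ∸ 1)))
      * (∑[ d ∈ evenDivisors (φ q) ]
          ( (ρ q d // φ d)
          * (∏[ p ∈ filter (λ p → p ∣? (φ q quo d)) (oddPrimeDivisors d) ] (((p ∸ 1) ^ 2) // (p *ℕ (p ∸ 2))))
          * (∏[ p ∈ filter (λ p → ¬? (p ∣? (φ q quo d))) (oddPrimeDivisors d) ] ((p ∸ 1) // (p ∸ 2)))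
          * (if ⌊ (2 ∣? d) ×-dec (2 ∣? (φ q quo d)) ⌋ then ½ else 1ℚ)))))
proposition7p3 q 3≤q = F.cyclicSubgroupCount , F.cyclicSubgroups-cardinality ,
  trans cyclicSubgroupCount-ρ (sym (trans
    -- Once the outer product is moved back into the sum, the two sides agree term by term in d.
    (*-distribˡ-∑ (∏ (oddPrimeDivisors (φ q)) (λ p → (p ∸ 2) // (p ∸ 1))) (evenDivisors (φ q)) _)
    (∑-cong (evenDivisors (φ q)) (λ {d} d∈ →
      coefficient-factors {φ q} {d} {φ q quo d} {{φ-nonZero q {{q≢0}}}}
        (quo-* (proj₁ (∈-filter⁻ (2 ∣?_) {xs = divisors (φ q)} d∈)))
        (proj₂ (∈-filter⁻ (2 ∣?_) {xs = divisors (φ q)} d∈)) (ρ q d)))))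
  where
  open ResidueUnits q 3≤q
  q≢0 : NonZero q
  q≢0 = ℕ.>-nonZero (ℕ.≤-trans (s≤s z≤n) 3≤q)
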